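{- For every $\epsilon>0$ and every prime $p$, there is an explicit construction yielding, for infinitely many $n$, a graph $G$ on $n$ vertices such that \[\vartheta(G)/\mathrm{minrank}_{\mathbb{F}_p}(G)=\Omega(n^{1-\epsilon}).\]
   Context: For a graph $G$ on $N$ vertices, the Lovász number is $\vartheta(G)=\max\sum_{i,j}b_{ij}$ over all $N\times N$ positive semidefinite matrices $B=(b_{ij})$ with trace $1$ and $b_{ij}=0$ whenever $ij$ is an edge. For a field $\mathbb{F}$, an $N\times N$ matrix $B=(b_{ij})$ over $\mathbb{F}$ represents $G$ if $b_{ii}\ne0$ for all $i$ and $b_{ij}=0$ whenever $i\neq j$ and $ij\notin E(G)$; $\mathrm{minrank}_{\mathbb{F}}(G)$ is the minimum rank over $\mathbb{F}$ of a matrix representing $G$. $\mathbb{F}_p$ is the field with $p$ elements. -}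

module Defs where

open import Algebra.Apartness using (HeytingField)
open import Algebra.Definitions using (Invertible)
open import Algebra.Structures using (IsCommutativeRing)
open import Data.Fin.Base using (Fin)
open import Data.Integer.Base as ℤ using (ℤ; +_)
import Data.Integer.Divisibility.Signed as ℤ
import Data.Integer.Properties as ℤ
import Data.Integer.Solver as ℤ
open import Data.Nat.Base as ℕ using (ℕ; zero; suc)
import Data.Nat.Coprimality as ℕ
import Data.Nat.Divisibility as ℕ
import Data.Nat.GCD as ℕ
import Data.Nat.Properties as ℕ
open import Data.Nat.Primality using (Prime; prime⇒irreducible; prime⇒nonTrivial)
open import Data.Product.Base using (Σ; Σ-syntax; ∃-syntax; _×_; _,_; proj₁; proj₂)
open import Data.Rational.Base as ℚ using (ℚ; 0ℚ; 1ℚ; ½)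
import Data.Rational.Properties as ℚ
import Data.Rational.Solver as ℚ
open import Data.Sum.Base using (_⊎_; inj₁; inj₂)
open import Data.Vec.Functional using (Vector; foldr)
open import Level using (0ℓ; _⊔_)
open import Relation.Binary.Core using (Rel)
open import Relation.Binary.Definitions using (Decidable; Symmetric; Irreflexive)
open import Relation.Binary.PropositionalEquality
  using (_≡_; refl; sym; trans; cong; cong₂; subst)
open import Relation.Nullary using (¬_; yes; no; contradiction)
open import Relation.Nullary.Decidable as Dec using (decidable-stable)

IsCauchy : (ℕ → ℚ) → Set
IsCauchy f = ∀ δ → 0ℚ ℚ.< δ → ∃[ N ] ∀ m n → N ℕ.≤ m → N ℕ.≤ n →
             ℚ.∣ f m ℚ.- f n ∣ ℚ.< δ

record ℝ : Set where
  constructor mkℝ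
  field
    approx : ℕ → ℚ
    cauchy : IsCauchy approx

open ℝ public

infix 4 _≤ℝ_ _<ℝ_ _≃ℝ_

record _≤ℝ_ (x y : ℝ) : Set where
  constructor mk≤
  field
    eventually : ∀ δ → 0ℚ ℚ.< δ → ∃[ N ] ∀ n → N ℕ.≤ n →
                 approx x n ℚ.≤ approx y n ℚ.+ δ

record _<ℝ_ (x y : ℝ) : Set where
  constructor mk<
  field
    gap        : ℚ
    gap>0      : 0ℚ ℚ.< gap
    eventually : ∃[ N ] ∀ n → N ℕ.≤ n → approx x n ℚ.+ gap ℚ.≤ approx y n

_≃ℝ_ : ℝ → ℝ → Set
x ≃ℝ y = x ≤ℝ y × y ≤ℝ x

private
  half : ∀ δ → ½ ℚ.* δ ℚ.+ ½ ℚ.* δ ≡ δ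
  half δ = trans (sym (ℚ.*-distribʳ-+ δ ½ ½)) (ℚ.*-identityˡ δ)

  half>0 : ∀ {δ} → 0ℚ ℚ.< δ → 0ℚ ℚ.< ½ ℚ.* δ
  half>0 {δ} δ>0 = subst (ℚ._< ½ ℚ.* δ) (ℚ.*-zeroʳ ½) (ℚ.*-monoʳ-<-pos ½ δ>0)

  ⊔-≤ : ∀ {M N k} → M ℕ.⊔ N ℕ.≤ k → M ℕ.≤ k × N ℕ.≤ k
  ⊔-≤ {M} {N} h = ℕ.≤-trans (ℕ.m≤m⊔n M N) h , ℕ.≤-trans (ℕ.m≤n⊔m M N) h

  eventuallyBounded : (x : ℝ) → ∃[ K ] 0ℚ ℚ.< K × ∃[ N ] ∀ n → N ℕ.≤ n → ℚ.∣ approx x n ∣ ℚ.≤ K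
  eventuallyBounded x with cauchy x 1ℚ (ℚ.positive⁻¹ 1ℚ)
  ... | N , close = 1ℚ ℚ.+ ℚ.∣ a ∣ , K>0 , N , bound
    where
    open ℚ.≤-Reasoning
    open ℚ.+-*-Solver
    a = approx x N
    K>0 : 0ℚ ℚ.< 1ℚ ℚ.+ ℚ.∣ a ∣
    K>0 = ℚ.+-mono-<-≤ (ℚ.positive⁻¹ 1ℚ) (ℚ.0≤∣p∣ a)
    bound : ∀ n → N ℕ.≤ n → ℚ.∣ approx x n ∣ ℚ.≤ 1ℚ ℚ.+ ℚ.∣ a ∣
    bound n N≤n = begin
      ℚ.∣ b ∣                      ≡⟨ cong ℚ.∣_∣ (solve 2 (λ b a → b := (b :- a) :+ a) refl b a) ⟩
      ℚ.∣ (b ℚ.- a) ℚ.+ a ∣        ≤⟨ ℚ.∣p+q∣≤∣p∣+∣q∣ (b ℚ.- a) a ⟩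
      ℚ.∣ b ℚ.- a ∣ ℚ.+ ℚ.∣ a ∣    ≤⟨ ℚ.+-monoˡ-≤ ℚ.∣ a ∣ (ℚ.<⇒≤ (close n N N≤n ℕ.≤-refl)) ⟩
      1ℚ ℚ.+ ℚ.∣ a ∣               ∎
      where b = approx x n

  +-close : ∀ a b c d δ → ℚ.∣ a ℚ.- c ∣ ℚ.< ½ ℚ.* δ → ℚ.∣ b ℚ.- d ∣ ℚ.< ½ ℚ.* δ →
            ℚ.∣ (a ℚ.+ b) ℚ.- (c ℚ.+ d) ∣ ℚ.< δ
  +-close a b c d δ h k = begin-strict
    ℚ.∣ (a ℚ.+ b) ℚ.- (c ℚ.+ d) ∣      ≡⟨ cong ℚ.∣_∣ (rearrange a b c d) ⟩
    ℚ.∣ (a ℚ.- c) ℚ.+ (b ℚ.- d) ∣      ≤⟨ ℚ.∣p+q∣≤∣p∣+∣q∣ (a ℚ.- c) (b ℚ.- d) ⟩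
    ℚ.∣ a ℚ.- c ∣ ℚ.+ ℚ.∣ b ℚ.- d ∣    <⟨ ℚ.+-mono-< h k ⟩
    ½ ℚ.* δ ℚ.+ ½ ℚ.* δ                ≡⟨ half δ ⟩
    δ                                  ∎
    where
    open ℚ.≤-Reasoning
    open ℚ.+-*-Solver
    rearrange : ∀ a b c d → (a ℚ.+ b) ℚ.- (c ℚ.+ d) ≡ (a ℚ.- c) ℚ.+ (b ℚ.- d)
    rearrange = solve 4 (λ a b c d → (a :+ b) :- (c :+ d) := (a :- c) :+ (b :- d)) refl

  neg-close : ∀ a b δ → ℚ.∣ b ℚ.- a ∣ ℚ.< δ → ℚ.∣ ℚ.- a ℚ.- (ℚ.- b) ∣ ℚ.< δ
  neg-close a b δ = subst (ℚ._< δ) (cong ℚ.∣_∣ (rearrange a b))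
    where
    open ℚ.+-*-Solver
    rearrange : ∀ a b → b ℚ.- a ≡ ℚ.- a ℚ.- (ℚ.- b)
    rearrange = solve 2 (λ a b → b :- a := (:- a) :- (:- b)) refl

  scale : ∀ K L → 0ℚ ℚ.< K → 0ℚ ℚ.< L → ∀ δ → 0ℚ ℚ.< δ →
          ∃[ η ] 0ℚ ℚ.< η × K ℚ.* η ℚ.+ η ℚ.* L ≡ δ
  scale K L K>0 L>0 δ δ>0 = η , η>0 , eq
    where
    instance
      K+L-pos : ℚ.Positive (K ℚ.+ L)
      K+L-pos = ℚ.positive (ℚ.+-mono-< K>0 L>0)
      K+L≢0 : ℚ.NonZero (K ℚ.+ L)
      K+L≢0 = ℚ.pos⇒nonZero (K ℚ.+ L)
      1/K+L-pos : ℚ.Positive (ℚ.1/ (K ℚ.+ L))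
      1/K+L-pos = ℚ.1/pos⇒pos (K ℚ.+ L)
    r η : ℚ
    r = ℚ.1/ (K ℚ.+ L)
    η = r ℚ.* δ
    η>0 : 0ℚ ℚ.< η
    η>0 = subst (ℚ._< η) (ℚ.*-zeroʳ r) (ℚ.*-monoʳ-<-pos r δ>0)
    open ℚ.≤-Reasoning
    eq : K ℚ.* η ℚ.+ η ℚ.* L ≡ δ
    eq = begin-equality
      K ℚ.* η ℚ.+ η ℚ.* L      ≡⟨ cong (K ℚ.* η ℚ.+_) (ℚ.*-comm η L) ⟩
      K ℚ.* η ℚ.+ L ℚ.* η      ≡⟨ ℚ.*-distribʳ-+ η K L ⟨
      (K ℚ.+ L) ℚ.* (r ℚ.* δ)  ≡⟨ ℚ.*-assoc (K ℚ.+ L) r δ ⟨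
      (K ℚ.+ L) ℚ.* r ℚ.* δ    ≡⟨ cong (ℚ._* δ) (ℚ.*-inverseʳ (K ℚ.+ L)) ⟩
      1ℚ ℚ.* δ                 ≡⟨ ℚ.*-identityˡ δ ⟩
      δ                        ∎

  *-close : ∀ a b c d K L η δ → 0ℚ ℚ.< K → 0ℚ ℚ.< L → ℚ.∣ a ∣ ℚ.≤ K → ℚ.∣ d ∣ ℚ.≤ L →
            ℚ.∣ a ℚ.- c ∣ ℚ.< η → ℚ.∣ b ℚ.- d ∣ ℚ.< η → K ℚ.* η ℚ.+ η ℚ.* L ≡ δ →
            ℚ.∣ a ℚ.* b ℚ.- c ℚ.* d ∣ ℚ.< δ
  *-close a b c d K L η δ K>0 L>0 a≤K d≤L a~c b~d eq = begin-strict
    ℚ.∣ a ℚ.* b ℚ.- c ℚ.* d ∣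
      ≡⟨ cong ℚ.∣_∣ (rearrange a b c d) ⟩
    ℚ.∣ a ℚ.* (b ℚ.- d) ℚ.+ (a ℚ.- c) ℚ.* d ∣
      ≤⟨ ℚ.∣p+q∣≤∣p∣+∣q∣ (a ℚ.* (b ℚ.- d)) ((a ℚ.- c) ℚ.* d) ⟩
    ℚ.∣ a ℚ.* (b ℚ.- d) ∣ ℚ.+ ℚ.∣ (a ℚ.- c) ℚ.* d ∣
      ≡⟨ cong₂ ℚ._+_ (ℚ.∣p*q∣≡∣p∣*∣q∣ a (b ℚ.- d)) (ℚ.∣p*q∣≡∣p∣*∣q∣ (a ℚ.- c) d) ⟩
    ℚ.∣ a ∣ ℚ.* ℚ.∣ b ℚ.- d ∣ ℚ.+ ℚ.∣ a ℚ.- c ∣ ℚ.* ℚ.∣ d ∣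
      ≤⟨ ℚ.+-mono-≤
           (ℚ.*-monoʳ-≤-nonNeg ℚ.∣ b ℚ.- d ∣ {{ℚ.∣-∣-nonNeg (b ℚ.- d)}} a≤K)
           (ℚ.*-monoˡ-≤-nonNeg ℚ.∣ a ℚ.- c ∣ {{ℚ.∣-∣-nonNeg (a ℚ.- c)}} d≤L) ⟩
    K ℚ.* ℚ.∣ b ℚ.- d ∣ ℚ.+ ℚ.∣ a ℚ.- c ∣ ℚ.* L
      <⟨ ℚ.+-mono-<
           (ℚ.*-monoʳ-<-pos K {{ℚ.positive K>0}} b~d)
           (ℚ.*-monoˡ-<-pos L {{ℚ.positive L>0}} a~c) ⟩
    K ℚ.* η ℚ.+ η ℚ.* L
      ≡⟨ eq ⟩
    δ ∎
    where
    open ℚ.≤-Reasoning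
    open ℚ.+-*-Solver
    rearrange : ∀ a b c d → a ℚ.* b ℚ.- c ℚ.* d ≡ a ℚ.* (b ℚ.- d) ℚ.+ (a ℚ.- c) ℚ.* d
    rearrange = solve 4 (λ a b c d → a :* b :- c :* d := a :* (b :- d) :+ (a :- c) :* d) refl

-- The convergence proofs are abstract so that normalising a real number only
-- exposes its approximations.
private abstract
  const-cauchy : ∀ q → IsCauchy (λ _ → q)
  const-cauchy q δ δ>0 =
    0 , λ _ _ _ _ → subst (ℚ._< δ) (cong ℚ.∣_∣ (sym (ℚ.+-inverseʳ q))) δ>0

  +-cauchy : ∀ x y → IsCauchy (λ n → approx x n ℚ.+ approx y n)
  +-cauchy x y δ δ>0 =
    let (M , closeˣ) = cauchy x (½ ℚ.* δ) (half>0 δ>0)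
        (N , closeʸ) = cauchy y (½ ℚ.* δ) (half>0 δ>0)
    in M ℕ.⊔ N , λ m n h k →
      +-close (approx x m) (approx y m) (approx x n) (approx y n) δ
        (closeˣ m n (proj₁ (⊔-≤ h)) (proj₁ (⊔-≤ k)))
        (closeʸ m n (proj₂ (⊔-≤ {M} h)) (proj₂ (⊔-≤ {M} k)))

  neg-cauchy : ∀ x → IsCauchy (λ n → ℚ.- approx x n)
  neg-cauchy x δ δ>0 =
    let (N , close) = cauchy x δ δ>0 in
    N , λ m n h k → neg-close (approx x m) (approx x n) δ (close n m k h)

  *-cauchy : ∀ x y → IsCauchy (λ n → approx x n ℚ.* approx y n)
  *-cauchy x y δ δ>0 =
    let (K , K>0 , P , boundˣ) = eventuallyBounded x
        (L , L>0 , Q , boundʸ) = eventuallyBounded y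
        (η , η>0 , small)      = scale K L K>0 L>0 δ δ>0
        (M , closeˣ)           = cauchy x η η>0
        (N , closeʸ)           = cauchy y η η>0
    in (P ℕ.⊔ M) ℕ.⊔ (Q ℕ.⊔ N) , λ m n h k →
      let (hP , hM) = ⊔-≤ {P} (proj₁ (⊔-≤ {P ℕ.⊔ M} h))
          (hQ , hN) = ⊔-≤ {Q} (proj₂ (⊔-≤ {P ℕ.⊔ M} h))
          (kP , kM) = ⊔-≤ {P} (proj₁ (⊔-≤ {P ℕ.⊔ M} k))
          (kQ , kN) = ⊔-≤ {Q} (proj₂ (⊔-≤ {P ℕ.⊔ M} k))
      in *-close (approx x m) (approx y m) (approx x n) (approx y n) K L η δ K>0 L>0
           (boundˣ m hP) (boundʸ n kQ) (closeˣ m n hM kM) (closeʸ m n hN kN) small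

infixl 6 _+ℝ_ _-ℝ_
infixl 7 _*ℝ_
infix  8 -ℝ_
infixr 8 _^ℝ_

fromℚ : ℚ → ℝ
fromℚ q = mkℝ (λ _ → q) (const-cauchy q)

fromℕ : ℕ → ℝ
fromℕ n = fromℚ (+ n ℚ./ 1)

0ℝ 1ℝ : ℝ
0ℝ = fromℚ 0ℚ
1ℝ = fromℚ 1ℚ

_+ℝ_ : ℝ → ℝ → ℝ
x +ℝ y = mkℝ (λ n → approx x n ℚ.+ approx y n) (+-cauchy x y)

-ℝ_ : ℝ → ℝ
-ℝ x = mkℝ (λ n → ℚ.- approx x n) (neg-cauchy x)

_-ℝ_ : ℝ → ℝ → ℝ
x -ℝ y = x +ℝ (-ℝ y)

_*ℝ_ : ℝ → ℝ → ℝ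
x *ℝ y = mkℝ (λ n → approx x n ℚ.* approx y n) (*-cauchy x y)

_^ℝ_ : ℝ → ℕ → ℝ
x ^ℝ zero  = 1ℝ
x ^ℝ suc k = x *ℝ x ^ℝ k

sumℝ : ∀ {n} → Vector ℝ n → ℝ
sumℝ = foldr _+ℝ_ 0ℝ

-- y = nˣ for a natural number n ≥ 1 and real x: y ≥ 0 lies above n^r for every
-- rational r ≤ x and below n^r for every rational r ≥ x.  Here
-- r = (a - a′)/(b + 1), and n^r ≤ y is written as n^a ≤ n^a′ · y^(b+1).
record IsPower (n : ℕ) (x y : ℝ) : Set where
  field
    nonNegative : 0ℝ ≤ℝ y
    above : ∀ a a′ b → fromℚ ((a ℤ.⊖ a′) ℚ./ suc b) ≤ℝ x →
            fromℕ (n ℕ.^ a) ≤ℝ fromℕ (n ℕ.^ a′) *ℝ y ^ℝ suc b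
    below : ∀ a a′ b → x ≤ℝ fromℚ ((a ℤ.⊖ a′) ℚ./ suc b) →
            fromℕ (n ℕ.^ a′) *ℝ y ^ℝ suc b ≤ℝ fromℕ (n ℕ.^ a)

record Graph (n : ℕ) : Set₁ where
  field
    Edge   : Rel (Fin n) 0ℓ
    edge?  : Decidable Edge
    symm   : Symmetric Edge
    irrefl : Irreflexive _≡_ Edge

Matrix : ∀ {a} → Set a → ℕ → Set a
Matrix A n = Fin n → Fin n → A

record PositiveSemidefinite {n} (B : Matrix ℝ n) : Set where
  field
    symmetric   : ∀ i j → B i j ≃ℝ B j i
    nonNegative : ∀ (x : Vector ℝ n) →
                  0ℝ ≤ℝ sumℝ λ i → sumℝ λ j → x i *ℝ B i j *ℝ x j

record LovászFeasible {n} (G : Graph n) (B : Matrix ℝ n) : Set where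
  open Graph G
  field
    psd     : PositiveSemidefinite B
    trace-1 : sumℝ (λ i → B i i) ≃ℝ 1ℝ
    zero-on-edges : ∀ i j → Edge i j → B i j ≃ℝ 0ℝ

entrySum : ∀ {n} → Matrix ℝ n → ℝ
entrySum B = sumℝ λ i → sumℝ λ j → B i j

record IsLovász {n} (G : Graph n) (t : ℝ) : Set where
  field
    attained : Σ[ B ∈ Matrix ℝ n ] LovászFeasible G B × entrySum B ≃ℝ t
    maximal  : ∀ B → LovászFeasible G B → entrySum B ≤ℝ t

module _ {c ℓ₁ ℓ₂} (F : HeytingField c ℓ₁ ℓ₂) where
  open HeytingField F using (Carrier; _≈_; _#_; _+_; _*_; 0#)

  LinearlyIndependent : ∀ {k n} → (Fin k → Vector Carrier n) → Set (c ⊔ ℓ₁)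
  LinearlyIndependent {k} v =
    ∀ (α : Vector Carrier k) → (∀ j → foldr _+_ 0# (λ i → α i * v i j) ≈ 0#) → ∀ i → α i ≈ 0#

  record HasRank {n} (B : Matrix Carrier n) (r : ℕ) : Set (c ⊔ ℓ₁) where
    field
      attained : Σ[ rows ∈ (Fin r → Fin n) ] LinearlyIndependent (λ i → B (rows i))
      maximal  : ∀ k (rows : Fin k → Fin n) →
                 LinearlyIndependent (λ i → B (rows i)) → k ℕ.≤ r

  record Represents {n} (B : Matrix Carrier n) (G : Graph n) : Set (ℓ₁ ⊔ ℓ₂) where
    open Graph G
    field
      diagonal : ∀ i → B i i # 0#
      nonEdge  : ∀ i j → ¬ i ≡ j → ¬ Edge i j → B i j ≈ 0#

  record IsMinrank {n} (G : Graph n) (m : ℕ) : Set (c ⊔ ℓ₁ ⊔ ℓ₂) where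
    field
      attained : Σ[ B ∈ Matrix Carrier n ] Represents B G × HasRank B m
      minimal  : ∀ B r → Represents B G → HasRank B r → m ℕ.≤ r

-- The field with p elements is ℤ with congruence modulo p as its equality, so a
-- matrix over it is an integer matrix read modulo p.
module _ (p : ℕ) where

  infix 4 _≈ₚ_

  record _≈ₚ_ (x y : ℤ) : Set where
    constructor mk≈
    field divides-difference : + p ℤ.∣ x ℤ.- y

  private
    open ℤ.+-*-Solver
    open _≈ₚ_ renaming (divides-difference to diff)

    via : ∀ {i j} → i ≡ j → + p ℤ.∣ i → + p ℤ.∣ j
    via = subst (+ p ℤ.∣_)

    ≡⇒≈ : ∀ {x y} → x ≡ y → x ≈ₚ y
    ≡⇒≈ {x} refl = mk≈ (via (sym (ℤ.+-inverseʳ x)) (ℤ.divides (+ 0) refl))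

    ≈-sym : ∀ {x y} → x ≈ₚ y → y ≈ₚ x
    ≈-sym {x} {y} e = mk≈ (via
      (solve 2 (λ x y → :- (x :- y) := y :- x) refl x y)
      (ℤ.∣m⇒∣-m (diff e)))

    ≈-trans : ∀ {x y z} → x ≈ₚ y → y ≈ₚ z → x ≈ₚ z
    ≈-trans {x} {y} {z} e f = mk≈ (via
      (solve 3 (λ x y z → (x :- y) :+ (y :- z) := x :- z) refl x y z)
      (ℤ.∣m∣n⇒∣m+n (diff e) (diff f)))

    +-cong : ∀ {x y u v} → x ≈ₚ y → u ≈ₚ v → x ℤ.+ u ≈ₚ y ℤ.+ v
    +-cong {x} {y} {u} {v} e f = mk≈ (via
      (solve 4 (λ x y u v → (x :- y) :+ (u :- v) := (x :+ u) :- (y :+ v)) refl x y u v)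
      (ℤ.∣m∣n⇒∣m+n (diff e) (diff f)))

    *-cong : ∀ {x y u v} → x ≈ₚ y → u ≈ₚ v → x ℤ.* u ≈ₚ y ℤ.* v
    *-cong {x} {y} {u} {v} e f = mk≈ (via
      (solve 4 (λ x y u v → x :* (u :- v) :+ v :* (x :- y) := x :* u :- y :* v) refl x y u v)
      (ℤ.∣m∣n⇒∣m+n (ℤ.∣n⇒∣m*n x (diff f)) (ℤ.∣n⇒∣m*n v (diff e))))

    neg-cong : ∀ {x y} → x ≈ₚ y → ℤ.- x ≈ₚ ℤ.- y
    neg-cong {x} {y} e = mk≈ (via
      (solve 2 (λ x y → :- (x :- y) := (:- x) :- (:- y)) refl x y)
      (ℤ.∣m⇒∣-m (diff e)))

    _≈?_ : Decidable _≈ₚ_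
    x ≈? y = Dec.map′ mk≈ diff (+ p ℤ.∣? x ℤ.- y)

    -- If p ∤ x then Bézout's identity for p and ∣ x ∣ inverts x modulo p.
    inverse : Prime p → ∀ x → ¬ + p ℤ.∣ x → ∃[ y ] y ℤ.* x ≈ₚ + 1
    inverse pr x p∤x = fromBézout (ℕ.coprime-Bézout coprime)
      where
      coprime : ℕ.Coprime p ℤ.∣ x ∣
      coprime (d∣p , d∣x) with prime⇒irreducible pr d∣p
      ... | inj₁ d≡1  = d≡1
      ... | inj₂ refl = contradiction (ℤ.∣ᵤ⇒∣ d∣x) p∤x

      invert∣x∣ : ∀ y → y ℤ.* + ℤ.∣ x ∣ ≈ₚ + 1 → ∃[ y ] y ℤ.* x ≈ₚ + 1
      invert∣x∣ y e with ℤ.+∣i∣≡i⊎+∣i∣≡-i x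
      ... | inj₁ eq = y , subst (λ z → y ℤ.* z ≈ₚ + 1) eq e
      ... | inj₂ eq = ℤ.- y , subst (_≈ₚ + 1)
        (trans (cong (y ℤ.*_) eq) (solve 2 (λ x y → y :* (:- x) := (:- y) :* x) refl x y)) e

      lift : ∀ a b c d → 1 ℕ.+ a ℕ.* b ≡ c ℕ.* d →
             + 1 ℤ.+ + a ℤ.* + b ≡ + c ℤ.* + d
      lift a b c d eq = trans (cong (λ z → + 1 ℤ.+ z) (sym (ℤ.pos-* a b)))
                          (trans (cong +_ eq) (ℤ.pos-* c d))

      fromBézout : ℕ.Bézout.Identity 1 p ℤ.∣ x ∣ → ∃[ y ] y ℤ.* x ≈ₚ + 1
      fromBézout (ℕ.Bézout.+- u v eq) = invert∣x∣ (ℤ.- (+ v)) (mk≈ (ℤ.divides (ℤ.- (+ u)) (trans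
        (solve 2 (λ v z → (:- v) :* z :- con (+ 1) := :- (con (+ 1) :+ v :* z)) refl (+ v) (+ ℤ.∣ x ∣))
        (trans (cong ℤ.-_ (lift v ℤ.∣ x ∣ u p eq)) (ℤ.neg-distribˡ-* (+ u) (+ p))))))
      fromBézout (ℕ.Bézout.-+ u v eq) = invert∣x∣ (+ v) (mk≈ (ℤ.divides (+ u) (trans
        (cong (λ z → z ℤ.- + 1) (sym (lift u p v ℤ.∣ x ∣ eq)))
        (solve 1 (λ z → con (+ 1) :+ z :- con (+ 1) := z) refl (+ u ℤ.* + p)))))

    ≈ₚ-isCommutativeRing : IsCommutativeRing _≈ₚ_ ℤ._+_ ℤ._*_ ℤ.-_ (+ 0) (+ 1)
    ≈ₚ-isCommutativeRing = record
      { isRing = record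
        { +-isAbelianGroup = record
          { isGroup = record
            { isMonoid = record
              { isSemigroup = record
                { isMagma = record
                  { isEquivalence = record { refl = ≡⇒≈ refl ; sym = ≈-sym ; trans = ≈-trans }
                  ; ∙-cong = +-cong
                  }
                ; assoc = λ x y z → ≡⇒≈ (ℤ.+-assoc x y z)
                }
              ; identity = (λ x → ≡⇒≈ (ℤ.+-identityˡ x)) , (λ x → ≡⇒≈ (ℤ.+-identityʳ x))
              }
            ; inverse = (λ x → ≡⇒≈ (ℤ.+-inverseˡ x)) , (λ x → ≡⇒≈ (ℤ.+-inverseʳ x))
            ; ⁻¹-cong = neg-cong
            }
          ; comm = λ x y → ≡⇒≈ (ℤ.+-comm x y)
          }
        ; *-cong = *-cong
        ; *-assoc = λ x y z → ≡⇒≈ (ℤ.*-assoc x y z)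
        ; *-identity = (λ x → ≡⇒≈ (ℤ.*-identityˡ x)) , (λ x → ≡⇒≈ (ℤ.*-identityʳ x))
        ; distrib = (λ x y z → ≡⇒≈ (ℤ.*-distribˡ-+ x y z)) , (λ x y z → ≡⇒≈ (ℤ.*-distribʳ-+ x y z))
        }
      ; *-comm = λ x y → ≡⇒≈ (ℤ.*-comm x y)
      }

    #⇒invertible : Prime p → ∀ {x y} → ¬ x ≈ₚ y → Invertible _≈ₚ_ (+ 1) ℤ._*_ (x ℤ.- y)
    #⇒invertible pr {x} {y} x#y with inverse pr (x ℤ.- y) (λ d → x#y (mk≈ d))
    ... | z , e = z , e , ≈-trans (≡⇒≈ (ℤ.*-comm (x ℤ.- y) z)) e

    invertible⇒# : Prime p → ∀ {x y} → Invertible _≈ₚ_ (+ 1) ℤ._*_ (x ℤ.- y) → ¬ x ≈ₚ y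
    invertible⇒# pr {x} {y} (z , e , _) x≈y =
      contradiction (ℕ.∣1⇒≡1 (ℤ.∣⇒∣ᵤ p∣1)) (ℕ.nonTrivial⇒≢1 {{prime⇒nonTrivial pr}})
      where
      p∣1 : + p ℤ.∣ + 1
      p∣1 = via
        (solve 1 (λ w → w :- (w :- con (+ 1)) := con (+ 1)) refl (z ℤ.* (x ℤ.- y)))
        (ℤ.∣m∣n⇒∣m-n (ℤ.∣n⇒∣m*n z (diff x≈y)) (diff e))

    #-cotrans : ∀ {x y} → ¬ x ≈ₚ y → ∀ z → ¬ x ≈ₚ z ⊎ ¬ z ≈ₚ y
    #-cotrans {x} x#y z with x ≈? z
    ... | yes x≈z = inj₂ λ z≈y → x#y (≈-trans x≈z z≈y)
    ... | no  x#z = inj₁ x#z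

  𝔽 : Prime p → HeytingField 0ℓ 0ℓ 0ℓ
  𝔽 pr = record
    { Carrier = ℤ
    ; _≈_     = _≈ₚ_
    ; _#_     = λ x y → ¬ x ≈ₚ y
    ; _+_     = ℤ._+_
    ; _*_     = ℤ._*_
    ; -_      = ℤ.-_
    ; 0#      = + 0
    ; 1#      = + 1
    ; isHeytingField = record
      { isHeytingCommutativeRing = record
        { isCommutativeRing   = ≈ₚ-isCommutativeRing
        ; isApartnessRelation = record
          { irrefl  = λ x≈y x#y → x#y x≈y
          ; sym     = λ x#y y≈x → x#y (≈-sym y≈x)
          ; cotrans = #-cotrans
          }
        ; #⇒invertible = #⇒invertible pr
        ; invertible⇒# = invertible⇒# pr
        }
      ; tight = λ x y → decidable-stable (x ≈? y) , λ x≈y x#y → x#y x≈y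
      }
    }

{-# OPTIONS --safe #-}

-- The vertices are the words of length q² over an alphabet of size r, where q ≥ 2 / ε is a power
-- of p and r → ∞; two distinct words are adjacent when the number d of positions in which they
-- differ is divisible by q.
--
-- Minrank: C(d + q - 1, q - 1) is divisible by p unless q divides d, and it is 1 for d = 0, so it
-- represents the graph.  As a polynomial of degree q - 1 in indicators it has rank O(r^(q - 1)).
--
-- Lovász number: let s = q² and let a = s - d be the number of agreements.  For each t < s the kernel
-- (s - t) + r (t + 1) C(a, t + 1) - (s - t) C(a, t) vanishes at a = t, is a nonnegative constant plus
-- a positive semidefinite kernel, and on the diagonal exceeds that constant by a factor O(r) only.
-- Adjacent words have a ∈ {0, q, …, (q - 1) q}, so the product of the kernels over these q values of t
-- is feasible up to scaling, and it shows ϑ = Ω(n / r^q) for n = r^s.  Hence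
-- ϑ / minrank = Ω(r^(s - 2q + 1)), which is at least n^(1 - 2/q).
module Submission where

open import Defs
open import Algebra.Apartness using (HeytingField)
open import Algebra.Bundles using (CommutativeRing)
import Algebra.Properties.Semiring.Sum as Sum
open import Data.Bool.Base using (Bool; true; false; not)
open import Data.Empty using (⊥-elim)
open import Data.Fin.Base as Fin using (Fin; zero; suc; toℕ; fromℕ<; finToFun; funToFin)
import Data.Fin.Properties as Fin
open import Data.Integer.Base as ℤ using (ℤ; +_)
import Data.Integer.DivMod as ℤ
import Data.Integer.Divisibility.Signed as ℤ
import Data.Integer.Properties as ℤ
import Data.Integer.Solver as ℤ
open import Data.Nat.Base as ℕ using (ℕ; zero; suc; _<_)
open import Data.Nat.Combinatorics using (_C_; nCk+nC[k+1]≡[n+1]C[k+1]; nC1≡n; nCn≡1; k>n⇒nCk≡0)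
import Data.Nat.Divisibility as ℕ
open import Data.Nat.Primality using (Prime; euclidsLemma; prime⇒nonZero; prime⇒nonTrivial)
import Data.Nat.Properties as ℕ
import Data.Nat.Solver as ℕ
open import Data.Product.Base using (Σ-syntax; ∃-syntax; _×_; _,_; proj₁; proj₂)
open import Data.Rational.Base as ℚ using (ℚ; 0ℚ; 1ℚ; ½; toℚᵘ)
import Data.Rational.Properties as ℚ
import Data.Rational.Solver as ℚ
import Data.Rational.Unnormalised.Base as ℚᵘ
import Data.Rational.Unnormalised.Properties as ℚᵘ
open import Data.Sum.Base using (_⊎_; inj₁; inj₂)
open import Data.Vec.Functional using (Vector) renaming (_∷_ to _◂_)
open import Function.Base using (_∘_; _on_)
open import Relation.Binary.PropositionalEquality
open import Relation.Nullary
open import Relation.Nullary.Decidable using (dec-true; dec-false; decidable-stable)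

open import Algebra.Definitions.RawSemiring ℚ.+-*-rawSemiring using (_^_)

module ∑ℤ = Sum ℤ.+-*-semiring
module ∑ℚ = Sum (CommutativeRing.semiring ℚ.+-*-commutativeRing)

-- Binomial coefficients.

pascal : ∀ n k → suc n C suc k ≡ n C k ℕ.+ n C suc k
pascal n k = sym (nCk+nC[k+1]≡[n+1]C[k+1] n k)

-- Pascal's rule splits the left side, and each half is absorbed one level down. The identity serves
-- `p∣C` and, through `C-absorbℤ`, the diagonal values of the kernels.
C-absorb : ∀ n k → suc k ℕ.* (suc n C suc k) ≡ suc n ℕ.* (n C k)
C-absorb zero    zero    = refl
C-absorb zero    (suc k) = ℕ.*-zeroʳ (2 ℕ.+ k)
C-absorb (suc n) zero    = trans (ℕ.+-identityʳ _)
  (trans (nC1≡n (2 ℕ.+ n)) (sym (ℕ.*-identityʳ (2 ℕ.+ n))))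
C-absorb (suc n) (suc k) = begin
  (2 ℕ.+ k) ℕ.* (suc (suc n) C suc (suc k))
    ≡⟨ cong ((2 ℕ.+ k) ℕ.*_) (pascal (suc n) (suc k)) ⟩
  (2 ℕ.+ k) ℕ.* (c ℕ.+ (suc n C suc (suc k)))
    ≡⟨ split (suc k) c (suc n C suc (suc k)) ⟩
  c ℕ.+ (suc k ℕ.* c ℕ.+ (2 ℕ.+ k) ℕ.* (suc n C suc (suc k)))
    ≡⟨ cong (c ℕ.+_) (cong₂ ℕ._+_ (C-absorb n k) (C-absorb n (suc k))) ⟩
  c ℕ.+ (suc n ℕ.* (n C k) ℕ.+ suc n ℕ.* (n C suc k))
    ≡⟨ cong (c ℕ.+_) (sym (ℕ.*-distribˡ-+ (suc n) (n C k) (n C suc k))) ⟩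
  c ℕ.+ suc n ℕ.* (n C k ℕ.+ n C suc k)
    ≡⟨ cong (λ z → c ℕ.+ suc n ℕ.* z) (pascal n k) ⟨
  (2 ℕ.+ n) ℕ.* c ∎
  where
  open ≡-Reasoning
  c = suc n C suc k
  split : ∀ m c d → (1 ℕ.+ m) ℕ.* (c ℕ.+ d) ≡ c ℕ.+ (m ℕ.* c ℕ.+ (1 ℕ.+ m) ℕ.* d)
  split = solve 3 (λ m c d → (con 1 :+ m) :* (c :+ d) := c :+ (m :* c :+ (con 1 :+ m) :* d)) refl
    where open ℕ.+-*-Solver

-- The difference is taken in ℤ to match the factor `+ s - + t` in `balance`.
C-absorbℤ : ∀ n k → + suc k ℤ.* + (n C suc k) ≡ (+ n ℤ.- + k) ℤ.* + (n C k)
C-absorbℤ n k = begin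
  + suc k ℤ.* + d                               ≡⟨ shift (+ k) (+ c) (+ d) ⟩
  + suc k ℤ.* (+ c ℤ.+ + d) ℤ.- + suc k ℤ.* + c ≡⟨ cong (λ z → + suc k ℤ.* + z ℤ.- + suc k ℤ.* + c) (pascal n k) ⟨
  + suc k ℤ.* + e ℤ.- + suc k ℤ.* + c           ≡⟨ cong (ℤ._- + suc k ℤ.* + c) absorb ⟩
  + suc n ℤ.* + c ℤ.- + suc k ℤ.* + c           ≡⟨ collect (+ n) (+ k) (+ c) ⟩
  (+ n ℤ.- + k) ℤ.* + c                         ∎
  where
  open ≡-Reasoning
  open ℤ.+-*-Solver
  c = n C k
  d = n C suc k
  e = suc n C suc k
  shift : ∀ k c d → (+ 1 ℤ.+ k) ℤ.* d ≡ (+ 1 ℤ.+ k) ℤ.* (c ℤ.+ d) ℤ.- (+ 1 ℤ.+ k) ℤ.* c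
  shift = solve 3 (λ k c d → (con (+ 1) :+ k) :* d :=
                   (con (+ 1) :+ k) :* (c :+ d) :- (con (+ 1) :+ k) :* c) refl
  collect : ∀ n k c → (+ 1 ℤ.+ n) ℤ.* c ℤ.- (+ 1 ℤ.+ k) ℤ.* c ≡ (n ℤ.- k) ℤ.* c
  collect = solve 3 (λ n k c → (con (+ 1) :+ n) :* c :- (con (+ 1) :+ k) :* c := (n :- k) :* c) refl
  absorb : + suc k ℤ.* + e ≡ + suc n ℤ.* + c
  absorb = trans (sym (ℤ.pos-* (suc k) e)) (trans (cong +_ (C-absorb n k)) (ℤ.pos-* (suc n) c))

C≤2^ : ∀ n k → n C k ℕ.≤ 2 ℕ.^ n
C≤2^ n       zero    = ℕ.m^n>0 2 n
C≤2^ zero    (suc k) = ℕ.z≤n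
C≤2^ (suc n) (suc k) = subst₂ ℕ._≤_ (sym (pascal n k)) (cong (2 ℕ.^ n ℕ.+_) (sym (ℕ.+-identityʳ _)))
  (ℕ.+-mono-≤ (C≤2^ n k) (C≤2^ n (suc k)))

-- Integer kernels on words.

-- Integer values serve both halves of the proof: they are read modulo `p` for the rank and embedded
-- in ℚ for the Lovász number.
Kernel : Set → Set
Kernel X = X → X → ℤ

Word : ℕ → ℕ → Set
Word r s = Fin s → Fin r

bit : Bool → ℕ
bit false = 0
bit true  = 1

_==_ : ∀ {r} → Fin r → Fin r → Bool
x == y = does (x Fin.≟ y)

==-refl : ∀ {r} (x : Fin r) → x == x ≡ true
==-refl x = dec-true (x Fin.≟ x) refl

==-sym : ∀ {r} (x y : Fin r) → x == y ≡ y == x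
==-sym x y with x Fin.≟ y
... | yes refl = sym (==-refl x)
... | no  x≢y  = sym (dec-false (y Fin.≟ x) (x≢y ∘ sym))

agree disagree : ∀ {r s} → Word r s → Word r s → ℕ
agree    {s = zero}  x y = 0
agree    {s = suc s} x y = bit (x zero == y zero) ℕ.+ agree (x ∘ suc) (y ∘ suc)
disagree {s = zero}  x y = 0
disagree {s = suc s} x y = bit (not (x zero == y zero)) ℕ.+ disagree (x ∘ suc) (y ∘ suc)

agree+disagree : ∀ {r s} (x y : Word r s) → agree x y ℕ.+ disagree x y ≡ s
agree+disagree {s = zero}  x y = refl
agree+disagree {s = suc s} x y with x zero == y zero
... | true  = cong suc (agree+disagree (x ∘ suc) (y ∘ suc))
... | false = trans (ℕ.+-suc _ _) (cong suc (agree+disagree (x ∘ suc) (y ∘ suc)))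

disagree-refl : ∀ {r s} (x : Word r s) → disagree x x ≡ 0
disagree-refl {s = zero}  x = refl
disagree-refl {s = suc s} x =
  cong₂ (λ b d → bit (not b) ℕ.+ d) (==-refl (x zero)) (disagree-refl (x ∘ suc))

disagree-sym : ∀ {r s} (x y : Word r s) → disagree x y ≡ disagree y x
disagree-sym {s = zero}  x y = refl
disagree-sym {s = suc s} x y =
  cong₂ (λ b d → bit (not b) ℕ.+ d) (==-sym (x zero) (y zero)) (disagree-sym (x ∘ suc) (y ∘ suc))

disagree≡0⇒≗ : ∀ {r s} (x y : Word r s) → disagree x y ≡ 0 → x ≗ y
disagree≡0⇒≗ {s = suc s} x y d≡0 i with x zero Fin.≟ y zero
disagree≡0⇒≗ {s = suc s} x y d≡0 zero    | yes x≡y = x≡y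
disagree≡0⇒≗ {s = suc s} x y d≡0 (suc i) | yes x≡y = disagree≡0⇒≗ (x ∘ suc) (y ∘ suc) d≡0 i

-- Pascal's rule, made linear in the indicator of one position. It drives every induction on the
-- length of the words.
pascal-bit : ∀ b n k → + ((bit b ℕ.+ n) C suc k) ≡ + (n C suc k) ℤ.+ + bit b ℤ.* + (n C k)
pascal-bit false n k = trans (sym (ℤ.+-identityʳ _)) (cong (λ z → + (n C suc k) ℤ.+ z) (sym (ℤ.*-zeroˡ (+ (n C k)))))
pascal-bit true  n k = trans (cong +_ (trans (pascal n k) (ℕ.+-comm (n C k) (n C suc k))))
  (cong (λ z → + (n C suc k) ℤ.+ z) (sym (ℤ.*-identityˡ (+ (n C k)))))

-- Read from right to left, it separates a function of two letters into products of functions of one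
-- letter each, the shape that `Gram` and `LowRank` ask for.
select : ∀ {r} (x : Fin r) (f : Fin r → ℤ) → ∑ℤ.sum (λ c → + bit (x == c) ℤ.* f c) ≡ f x
select {suc r} zero f = begin
  + 1 ℤ.* f zero ℤ.+ ∑ℤ.sum (λ c → + 0 ℤ.* f (suc c))
    ≡⟨ cong₂ ℤ._+_ (ℤ.*-identityˡ (f zero))
         (trans (∑ℤ.sum-cong-≗ (λ c → ℤ.*-zeroˡ (f (suc c)))) (∑ℤ.sum-replicate-zero r)) ⟩
  f zero ℤ.+ + 0
    ≡⟨ ℤ.+-identityʳ (f zero) ⟩
  f zero ∎
  where open ≡-Reasoning
select (suc x) f = trans (cong (ℤ._+ ∑ℤ.sum (λ c → + bit (x == c) ℤ.* f (suc c))) (ℤ.*-zeroˡ (f zero)))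
  (trans (ℤ.+-identityˡ _) (select x (f ∘ suc)))

-- Positive semidefinite kernels.

-- A certificate of positive semidefiniteness: a finite sum of weighted squares, kept as a tree so
-- that products of kernels can be formed by recursion.
data Gram {X : Set} (K : Kernel X) : Set where
  square : ∀ (w : ℕ) (φ : X → ℤ) → (∀ x y → K x y ≡ + w ℤ.* (φ x ℤ.* φ y)) → Gram K
  plus   : ∀ {L M} → Gram L → Gram M → (∀ x y → K x y ≡ L x y ℤ.+ M x y) → Gram K

module _ {X : Set} where

  gram-≗ : {K L : Kernel X} → (∀ x y → L x y ≡ K x y) → Gram K → Gram L
  gram-≗ e (square w φ f) = square w φ (λ x y → trans (e x y) (f x y))
  gram-≗ e (plus g h f)   = plus g h (λ x y → trans (e x y) (f x y))

  gram-const : ∀ w → Gram {X} (λ _ _ → + w)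
  gram-const w = square w (λ _ → + 1) (λ _ _ → sym (ℤ.*-identityʳ (+ w)))

  gram-+ : {K L : Kernel X} → Gram K → Gram L → Gram (λ x y → K x y ℤ.+ L x y)
  gram-+ g h = plus g h (λ _ _ → refl)

  gram-on : {Y : Set} (π : Y → X) {K : Kernel X} → Gram K → Gram (K on π)
  gram-on π (square w φ f) = square w (φ ∘ π) (λ x y → f (π x) (π y))
  gram-on π (plus g h f)   = plus (gram-on π g) (gram-on π h) (λ x y → f (π x) (π y))

  gram-∑ : ∀ {n} {K : Fin n → Kernel X} → (∀ c → Gram (K c)) →
           Gram (λ x y → ∑ℤ.sum (λ c → K c x y))
  gram-∑ {zero}  g = gram-const 0
  gram-∑ {suc n} g = gram-+ (g zero) (gram-∑ (g ∘ suc))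

  -- The Schur product theorem: two squares multiply to the square of `φ ψ`, and sums distribute.
  gram-* : {K L : Kernel X} → Gram K → Gram L → Gram (λ x y → K x y ℤ.* L x y)
  gram-* (square w φ e) (square v ψ f) = square (w ℕ.* v) (λ x → φ x ℤ.* ψ x) λ x y →
    trans (cong₂ ℤ._*_ (e x y) (f x y))
      (trans (shuffle (+ w) (+ v) (φ x) (φ y) (ψ x) (ψ y))
        (cong (ℤ._* ((φ x ℤ.* ψ x) ℤ.* (φ y ℤ.* ψ y))) (sym (ℤ.pos-* w v))))
    where
    open ℤ.+-*-Solver
    shuffle : ∀ w v a b c d → (w ℤ.* (a ℤ.* b)) ℤ.* (v ℤ.* (c ℤ.* d)) ≡ (w ℤ.* v) ℤ.* ((a ℤ.* c) ℤ.* (b ℤ.* d))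
    shuffle = solve 6 (λ w v a b c d → (w :* (a :* b)) :* (v :* (c :* d)) := (w :* v) :* ((a :* c) :* (b :* d))) refl
  gram-* {L = L} (plus {K₁} {K₂} g h e) k = plus (gram-* g k) (gram-* h k)
    (λ x y → trans (cong (ℤ._* L x y) (e x y)) (ℤ.*-distribʳ-+ (L x y) (K₁ x y) (K₂ x y)))
  gram-* {K = K} g@(square _ _ _) (plus {L₁} {L₂} h k f) = plus (gram-* g h) (gram-* g k)
    (λ x y → trans (cong (K x y ℤ.*_) (f x y)) (ℤ.*-distribˡ-+ (K x y) (L₁ x y) (L₂ x y)))

gram-δ : ∀ {r} → Gram {Fin r} (λ x y → + bit (x == y))
gram-δ = gram-≗ (λ x y → trans (cong (+_ ∘ bit) (==-sym x y)) (sym (select x (λ c → + bit (y == c)))))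
  (gram-∑ (λ c → square 1 (λ x → + bit (x == c)) (λ _ _ → sym (ℤ.*-identityˡ _))))

-- This is the square of the symmetric matrix `r I - J`, where `J` is all ones, because `J² = r J`.
gram-center : ∀ {r} → Gram {Fin r} (λ x y → + r ℤ.* (+ r ℤ.* + bit (x == y) ℤ.- + 1))
gram-center {r} = gram-≗ (λ x y → sym (total x y))
  (gram-∑ (λ c → square 1 (λ x → + r ℤ.* + bit (x == c) ℤ.- + 1) (λ _ _ → sym (ℤ.*-identityˡ _))))
  where
  open ≡-Reasoning
  open ℤ.+-*-Solver
  ⟪_⟫ : Bool → ℤ
  ⟪ b ⟫ = + bit b
  expand : ∀ r a b → (r ℤ.* a ℤ.- + 1) ℤ.* (r ℤ.* b ℤ.- + 1) ≡
                     a ℤ.* (r ℤ.* (r ℤ.* b ℤ.- + 1)) ℤ.+ (b ℤ.* (ℤ.- r) ℤ.+ + 1)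
  expand = solve 3 (λ r a b → (r :* a :- con (+ 1)) :* (r :* b :- con (+ 1)) :=
    a :* (r :* (r :* b :- con (+ 1))) :+ (b :* (:- r) :+ con (+ 1))) refl
  ∑1 : ∀ n → ∑ℤ.sum {n} (λ _ → + 1) ≡ + n
  ∑1 zero    = refl
  ∑1 (suc n) = cong (λ z → + 1 ℤ.+ z) (∑1 n)
  total : ∀ x y → ∑ℤ.sum (λ c → (+ r ℤ.* ⟪ x == c ⟫ ℤ.- + 1) ℤ.* (+ r ℤ.* ⟪ y == c ⟫ ℤ.- + 1)) ≡
                  + r ℤ.* (+ r ℤ.* ⟪ x == y ⟫ ℤ.- + 1)
  total x y = begin
    ∑ℤ.sum (λ c → (+ r ℤ.* ⟪ x == c ⟫ ℤ.- + 1) ℤ.* (+ r ℤ.* ⟪ y == c ⟫ ℤ.- + 1))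
      ≡⟨ ∑ℤ.sum-cong-≗ (λ c → expand (+ r) ⟪ x == c ⟫ ⟪ y == c ⟫) ⟩
    ∑ℤ.sum (λ c → ⟪ x == c ⟫ ℤ.* h c ℤ.+ (⟪ y == c ⟫ ℤ.* (ℤ.- + r) ℤ.+ + 1))
      ≡⟨ ∑ℤ.∑-distrib-+ (λ c → ⟪ x == c ⟫ ℤ.* h c) _ ⟩
    ∑ℤ.sum (λ c → ⟪ x == c ⟫ ℤ.* h c) ℤ.+ ∑ℤ.sum (λ c → ⟪ y == c ⟫ ℤ.* (ℤ.- + r) ℤ.+ + 1)
      ≡⟨ cong₂ ℤ._+_ (select x h)
           (∑ℤ.∑-distrib-+ (λ c → ⟪ y == c ⟫ ℤ.* (ℤ.- + r)) (λ _ → + 1)) ⟩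
    h x ℤ.+ (∑ℤ.sum (λ c → ⟪ y == c ⟫ ℤ.* (ℤ.- + r)) ℤ.+ ∑ℤ.sum {r} (λ _ → + 1))
      ≡⟨ cong (λ z → h x ℤ.+ z) (cong₂ ℤ._+_ (select y (λ _ → ℤ.- + r)) (∑1 r)) ⟩
    h x ℤ.+ (ℤ.- + r ℤ.+ + r)
      ≡⟨ cong (λ z → h x ℤ.+ z) (ℤ.+-inverseˡ (+ r)) ⟩
    h x ℤ.+ + 0
      ≡⟨ ℤ.+-identityʳ (h x) ⟩
    h x
      ≡⟨ cong (λ b → + r ℤ.* (+ r ℤ.* ⟪ b ⟫ ℤ.- + 1)) (==-sym y x) ⟩
    + r ℤ.* (+ r ℤ.* ⟪ x == y ⟫ ℤ.- + 1) ∎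
    where
    h : Fin r → ℤ
    h c = + r ℤ.* (+ r ℤ.* ⟪ y == c ⟫ ℤ.- + 1)

-- `C(a, t)` counts the `t`-sets of positions on which the words agree, so it is a sum of products
-- of equality indicators. The induction asks whether the set contains the first position.
gram-C : ∀ {r} s t → Gram {Word r s} (λ x y → + (agree x y C t))
gram-C s       zero    = gram-const 1
gram-C zero    (suc t) = gram-const 0
gram-C (suc s) (suc t) = plus (gram-on (_∘ suc) (gram-C s (suc t)))
  (gram-* (gram-on (λ x → x zero) gram-δ) (gram-on (_∘ suc) (gram-C s t)))
  (λ x y → pascal-bit (x zero == y zero) (agree (x ∘ suc) (y ∘ suc)) t)

-- Up to the factor r, the sum of ∏_{i ∈ T} [xᵢ = yᵢ] · (r [xⱼ = yⱼ] - 1) over the sets T of t positions and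
-- the positions j ∉ T.
balance : ℕ → ℕ → ℕ → ℕ → ℤ
balance r s t a = + r ℤ.* (+ r ℤ.* (+ suc t ℤ.* + (a C suc t)) ℤ.- (+ s ℤ.- + t) ℤ.* + (a C t))

-- The induction follows the sum over `T` and `j`. The three kernels in the last clause are the
-- cases that the first position is neither in `T` nor `j`, lies in `T`, or is `j`.
gram-balance : ∀ {r} s t → Gram {Word r s} (λ x y → balance r s t (agree x y))
gram-balance {r} zero zero = gram-≗ (λ _ _ → vanish (+ r)) (gram-const 0)
  where
  open ℤ.+-*-Solver
  vanish : ∀ r → r ℤ.* (r ℤ.* (+ 1 ℤ.* + 0) ℤ.- (+ 0 ℤ.- + 0) ℤ.* + 1) ≡ + 0
  vanish = solve 1 (λ r → r :* (r :* (con (+ 1) :* con (+ 0)) :- (con (+ 0) :- con (+ 0)) :* con (+ 1)) := con (+ 0)) refl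
gram-balance {r} zero (suc t) = gram-≗ (λ _ _ → vanish (+ r) (+ t)) (gram-const 0)
  where
  open ℤ.+-*-Solver
  vanish : ∀ r t → r ℤ.* (r ℤ.* ((+ 2 ℤ.+ t) ℤ.* + 0) ℤ.- (+ 0 ℤ.- (+ 1 ℤ.+ t)) ℤ.* + 0) ≡ + 0
  vanish = solve 2 (λ r t → r :* (r :* ((con (+ 2) :+ t) :* con (+ 0)) :- (con (+ 0) :- (con (+ 1) :+ t)) :* con (+ 0)) := con (+ 0)) refl
gram-balance {r} (suc s) zero = plus (gram-on (_∘ suc) (gram-balance s 0)) (gram-on (λ x → x zero) gram-center)
  λ x y → let b = x zero == y zero ; a = agree (x ∘ suc) (y ∘ suc) in
    trans (cong (λ z → + r ℤ.* (+ r ℤ.* (+ 1 ℤ.* z) ℤ.- (+ suc s ℤ.- + 0) ℤ.* + 1)) (pascal-bit b a 0))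
      (step (+ r) (+ s) (+ (a C 1)) (+ bit b))
  where
  open ℤ.+-*-Solver
  step : ∀ r s c b → r ℤ.* (r ℤ.* (+ 1 ℤ.* (c ℤ.+ b ℤ.* + 1)) ℤ.- ((+ 1 ℤ.+ s) ℤ.- + 0) ℤ.* + 1) ≡
    r ℤ.* (r ℤ.* (+ 1 ℤ.* c) ℤ.- (s ℤ.- + 0) ℤ.* + 1) ℤ.+ r ℤ.* (r ℤ.* b ℤ.- + 1)
  step = solve 4 (λ r s c b → r :* (r :* (con (+ 1) :* (c :+ b :* con (+ 1))) :- ((con (+ 1) :+ s) :- con (+ 0)) :* con (+ 1)) :=
    r :* (r :* (con (+ 1) :* c) :- (s :- con (+ 0)) :* con (+ 1)) :+ r :* (r :* b :- con (+ 1))) refl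
gram-balance {r} (suc s) (suc t) =
  plus (gram-+ (gram-on (_∘ suc) (gram-balance s (suc t)))
               (gram-* (gram-on (λ x → x zero) gram-δ) (gram-on (_∘ suc) (gram-balance s t))))
       (gram-* (gram-on (λ x → x zero) gram-center) (gram-on (_∘ suc) (gram-C s (suc t))))
  λ x y → let b = x zero == y zero ; a = agree (x ∘ suc) (y ∘ suc) in
    trans (cong₂ (λ u v → + r ℤ.* (+ r ℤ.* (+ suc (suc t) ℤ.* u) ℤ.- (+ suc s ℤ.- + suc t) ℤ.* v))
                 (pascal-bit b a (suc t)) (pascal-bit b a t))
      (step (+ r) (+ s) (+ t) (+ (a C suc (suc t))) (+ (a C suc t)) (+ (a C t)) (+ bit b))
  where
  open ℤ.+-*-Solver
  step : ∀ r s t c d e b →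
    r ℤ.* (r ℤ.* ((+ 2 ℤ.+ t) ℤ.* (c ℤ.+ b ℤ.* d)) ℤ.- ((+ 1 ℤ.+ s) ℤ.- (+ 1 ℤ.+ t)) ℤ.* (d ℤ.+ b ℤ.* e)) ≡
    (r ℤ.* (r ℤ.* ((+ 2 ℤ.+ t) ℤ.* c) ℤ.- (s ℤ.- (+ 1 ℤ.+ t)) ℤ.* d) ℤ.+
     b ℤ.* (r ℤ.* (r ℤ.* ((+ 1 ℤ.+ t) ℤ.* d) ℤ.- (s ℤ.- t) ℤ.* e))) ℤ.+
    (r ℤ.* (r ℤ.* b ℤ.- + 1)) ℤ.* d
  step = solve 7 (λ r s t c d e b →
    r :* (r :* ((con (+ 2) :+ t) :* (c :+ b :* d)) :- ((con (+ 1) :+ s) :- (con (+ 1) :+ t)) :* (d :+ b :* e)) :=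
    (r :* (r :* ((con (+ 2) :+ t) :* c) :- (s :- (con (+ 1) :+ t)) :* d) :+
     b :* (r :* (r :* ((con (+ 1) :+ t) :* d) :- (s :- t) :* e))) :+
    (r :* (r :* b :- con (+ 1))) :* d) refl

-- Kernels of low rank.

-- The index counts the products `φ x * ψ y`. Such a decomposition over ℤ bounds the rank modulo
-- every prime.
data LowRank {X : Set} : ℕ → Kernel X → Set where
  null : ∀ {K} → (∀ x y → K x y ≡ + 0) → LowRank 0 K
  cons : ∀ {D K L} (φ ψ : X → ℤ) → LowRank D L →
         (∀ x y → K x y ≡ φ x ℤ.* ψ y ℤ.+ L x y) → LowRank (suc D) K

module _ {X : Set} where

  lowRank-≗ : ∀ {D} {K L : Kernel X} → (∀ x y → L x y ≡ K x y) → LowRank D K → LowRank D L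
  lowRank-≗ e (null f)       = null (λ x y → trans (e x y) (f x y))
  lowRank-≗ e (cons φ ψ l f) = cons φ ψ l (λ x y → trans (e x y) (f x y))

  lowRank-const : ∀ z → LowRank {X} 1 (λ _ _ → z)
  lowRank-const z = cons (λ _ → z) (λ _ → + 1) (null (λ _ _ → refl))
    (λ _ _ → sym (trans (ℤ.+-identityʳ _) (ℤ.*-identityʳ z)))

  lowRank-+ : ∀ {D E} {K L : Kernel X} → LowRank D K → LowRank E L →
              LowRank (D ℕ.+ E) (λ x y → K x y ℤ.+ L x y)
  lowRank-+ {L = L} (null e) l =
    lowRank-≗ (λ x y → trans (cong (ℤ._+ L x y) (e x y)) (ℤ.+-identityˡ (L x y))) l
  lowRank-+ {L = L} (cons {L = K} φ ψ k e) l = cons φ ψ (lowRank-+ k l)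
    (λ x y → trans (cong (ℤ._+ L x y) (e x y)) (ℤ.+-assoc (φ x ℤ.* ψ y) (K x y) (L x y)))

  lowRank-∑ : ∀ {n D} {K : Fin n → Kernel X} → (∀ c → LowRank D (K c)) →
              LowRank (n ℕ.* D) (λ x y → ∑ℤ.sum (λ c → K c x y))
  lowRank-∑ {zero}  l = null (λ _ _ → refl)
  lowRank-∑ {suc n} l = lowRank-+ (l zero) (lowRank-∑ (l ∘ suc))

  -- A factor of the form `g x * h y` is absorbed into each product, so the number of terms does not
  -- grow.
  lowRank-scale : ∀ {Y : Set} {D} (π : Y → X) (g h : Y → ℤ) {K : Kernel X} → LowRank D K →
                  LowRank D (λ x y → (g x ℤ.* h y) ℤ.* K (π x) (π y))
  lowRank-scale π g h (null e) =
    null (λ x y → trans (cong (λ z → (g x ℤ.* h y) ℤ.* z) (e (π x) (π y))) (ℤ.*-zeroʳ (g x ℤ.* h y)))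
  lowRank-scale π g h (cons {L = L} φ ψ l e) =
    cons (λ x → g x ℤ.* φ (π x)) (λ y → h y ℤ.* ψ (π y)) (lowRank-scale π g h l) λ x y →
      trans (cong (λ z → (g x ℤ.* h y) ℤ.* z) (e (π x) (π y)))
        (expand (g x) (h y) (φ (π x)) (ψ (π y)) (L (π x) (π y)))
    where
    open ℤ.+-*-Solver
    expand : ∀ a b c d e → (a ℤ.* b) ℤ.* (c ℤ.* d ℤ.+ e) ≡ (a ℤ.* c) ℤ.* (b ℤ.* d) ℤ.+ (a ℤ.* b) ℤ.* e
    expand = solve 5 (λ a b c d e → (a :* b) :* (c :* d :+ e) := (a :* c) :* (b :* d) :+ (a :* b) :* e) refl

  lowRank-factor : ∀ {D} {K : Kernel X} → LowRank D K →
    Σ[ φ ∈ (Fin D → X → ℤ) ] Σ[ ψ ∈ (Fin D → X → ℤ) ]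
    (∀ x y → K x y ≡ ∑ℤ.sum (λ l → φ l x ℤ.* ψ l y))
  lowRank-factor (null e) = (λ ()) , (λ ()) , e
  lowRank-factor (cons φ ψ l e) with lowRank-factor l
  ... | φ′ , ψ′ , e′ = (φ ◂ φ′) , (ψ ◂ ψ′) , λ x y →
    trans (e x y) (cong (λ z → φ x ℤ.* ψ y ℤ.+ z) (e′ x y))

-- The number of terms produced by `lowRank-binomial`: the first position is either skipped or used,
-- and using it costs a factor `r`.
binomialRank : ℕ → ℕ → ℕ → ℕ
binomialRank r s       zero    = 1
binomialRank r zero    (suc j) = 1
binomialRank r (suc s) (suc j) = binomialRank r s (suc j) ℕ.+ r ℕ.* binomialRank r s j

-- Crude in `s`, which stays fixed while `r` grows; what matters is the exponent of `r`.
binomialRank≤ : ∀ r s j → .{{ℕ.NonZero r}} → binomialRank r s j ℕ.≤ 2 ℕ.^ s ℕ.* r ℕ.^ j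
binomialRank≤ r s       zero    = subst (1 ℕ.≤_) (sym (ℕ.*-identityʳ (2 ℕ.^ s))) (ℕ.m^n>0 2 s)
binomialRank≤ r zero    (suc j) = subst (1 ℕ.≤_) (sym (ℕ.+-identityʳ (r ℕ.^ suc j))) (ℕ.m^n>0 r (suc j))
binomialRank≤ r (suc s) (suc j) = ℕ.≤-trans
  (ℕ.+-mono-≤ (binomialRank≤ r s (suc j)) (ℕ.*-monoʳ-≤ r (binomialRank≤ r s j)))
  (ℕ.≤-reflexive (collect (2 ℕ.^ s) r (r ℕ.^ j)))
  where
  open ℕ.+-*-Solver
  collect : ∀ t r u → t ℕ.* (r ℕ.* u) ℕ.+ r ℕ.* (t ℕ.* u) ≡ 2 ℕ.* t ℕ.* (r ℕ.* u)
  collect = solve 3 (λ t r u → t :* (r :* u) :+ r :* (t :* u) := con 2 :* t :* (r :* u)) refl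

-- Pascal's rule peels off one position at a time, while the offset `e` is carried along unchanged.
-- The minrank bound takes `e` equal to `j`.
lowRank-binomial : ∀ {r} s j e →
  LowRank {Word r s} (binomialRank r s j) (λ x y → + ((disagree x y ℕ.+ e) C j))
lowRank-binomial s       zero    e = lowRank-const (+ 1)
lowRank-binomial zero    (suc j) e = lowRank-const (+ (e C suc j))
lowRank-binomial {r} (suc s) (suc j) e = lowRank-≗ step
  (lowRank-+
    (lowRank-≗ (λ x y → sym (ℤ.*-identityˡ (tail (suc j) x y)))
      (lowRank-scale (_∘ suc) (λ _ → + 1) (λ _ → + 1) (lowRank-binomial s (suc j) e)))
    -- The disagreement indicator is the sum over letters `c` of `[x = c] [c ≠ y]`, that is, `r`
    -- products.
    (lowRank-∑ {n = r} λ c → lowRank-scale (_∘ suc)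
      (λ x → + bit (x zero == c)) (λ y → + bit (not (c == y zero))) (lowRank-binomial s j e)))
  where
  open ≡-Reasoning
  tail : ℕ → Kernel (Word r (suc s))
  tail j x y = + ((disagree (x ∘ suc) (y ∘ suc) ℕ.+ e) C j)
  step : ∀ x y → + ((disagree x y ℕ.+ e) C suc j) ≡ tail (suc j) x y ℤ.+
    ∑ℤ.sum (λ c → (+ bit (x zero == c) ℤ.* + bit (not (c == y zero))) ℤ.* tail j x y)
  step x y = begin
    + ((disagree x y ℕ.+ e) C suc j)
      ≡⟨ cong (λ m → + (m C suc j)) (ℕ.+-assoc (bit b) (disagree (x ∘ suc) (y ∘ suc)) e) ⟩
    + ((bit b ℕ.+ (disagree (x ∘ suc) (y ∘ suc) ℕ.+ e)) C suc j)
      ≡⟨ pascal-bit b _ j ⟩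
    tail (suc j) x y ℤ.+ + bit b ℤ.* tail j x y
      ≡⟨ cong (λ z → tail (suc j) x y ℤ.+ z)
           (select (x zero) (λ c → + bit (not (c == y zero)) ℤ.* tail j x y)) ⟨
    tail (suc j) x y ℤ.+ ∑ℤ.sum (λ c → + bit (x zero == c) ℤ.* (+ bit (not (c == y zero)) ℤ.* tail j x y))
      ≡⟨ cong (λ z → tail (suc j) x y ℤ.+ z) (∑ℤ.sum-cong-≗ λ c →
           ℤ.*-assoc (+ bit (x zero == c)) (+ bit (not (c == y zero))) (tail j x y)) ⟨
    tail (suc j) x y ℤ.+ ∑ℤ.sum (λ c → (+ bit (x zero == c) ℤ.* + bit (not (c == y zero))) ℤ.* tail j x y) ∎
    where b = not (x zero == y zero)

-- Divisibility and rank modulo `p`.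

funToFin-cong : ∀ {m n} {f g : Fin m → Fin n} → f ≗ g → funToFin f ≡ funToFin g
funToFin-cong {zero}  f≗g = refl
funToFin-cong {suc m} f≗g = cong₂ Fin.combine (f≗g zero) (funToFin-cong (f≗g ∘ suc))

finToFun-injective : ∀ {m n} {i j : Fin (n ℕ.^ m)} → finToFun {n} {m} i ≗ finToFun j → i ≡ j
finToFun-injective {m} {n} {i} {j} e =
  trans (sym (Fin.funToFin-finToFin {m} {n} i)) (trans (funToFin-cong e) (Fin.funToFin-finToFin {m} {n} j))

∣-∑ : ∀ {d n} (f : Fin n → ℤ) → (∀ i → d ℤ.∣ f i) → d ℤ.∣ ∑ℤ.sum f
∣-∑ {n = zero}  f h = ℤ.divides (+ 0) refl
∣-∑ {n = suc n} f h = ℤ.∣m∣n⇒∣m+n (h zero) (∣-∑ (f ∘ suc) (h ∘ suc))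

%ℕ≡⇒∣- : ∀ a b d .{{_ : ℕ.NonZero d}} → a ℤ.%ℕ d ≡ b ℤ.%ℕ d → + d ℤ.∣ a ℤ.- b
%ℕ≡⇒∣- a b d e = ℤ.divides (a ℤ./ℕ d ℤ.- b ℤ./ℕ d) (begin
  a ℤ.- b
    ≡⟨ cong₂ ℤ._-_ (ℤ.a≡a%ℕn+[a/ℕn]*n a d) (ℤ.a≡a%ℕn+[a/ℕn]*n b d) ⟩
  (+ (a ℤ.%ℕ d) ℤ.+ a ℤ./ℕ d ℤ.* + d) ℤ.- (+ (b ℤ.%ℕ d) ℤ.+ b ℤ./ℕ d ℤ.* + d)
    ≡⟨ cong (λ z → (+ z ℤ.+ a ℤ./ℕ d ℤ.* + d) ℤ.- (+ (b ℤ.%ℕ d) ℤ.+ b ℤ./ℕ d ℤ.* + d)) e ⟩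
  (+ (b ℤ.%ℕ d) ℤ.+ a ℤ./ℕ d ℤ.* + d) ℤ.- (+ (b ℤ.%ℕ d) ℤ.+ b ℤ./ℕ d ℤ.* + d)
    ≡⟨ collect (+ (b ℤ.%ℕ d)) (a ℤ./ℕ d) (b ℤ./ℕ d) (+ d) ⟩
  (a ℤ./ℕ d ℤ.- b ℤ./ℕ d) ℤ.* + d ∎)
  where
  open ≡-Reasoning
  open ℤ.+-*-Solver
  collect : ∀ r u v d → (r ℤ.+ u ℤ.* d) ℤ.- (r ℤ.+ v ℤ.* d) ≡ (u ℤ.- v) ℤ.* d
  collect = solve 4 (λ r u v d → (r :+ u :* d) :- (r :+ v :* d) := (u :- v) :* d) refl

∣-⇒≡ : ∀ {d a b} → a ℕ.< d → b ℕ.< d → + d ℤ.∣ + a ℤ.- + b → a ≡ b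
∣-⇒≡ {d} {a} {b} a<d b<d d∣a-b = ℤ.+-injective (ℤ.i-j≡0⇒i≡j (+ a) (+ b) (ℤ.∣i∣≡0⇒i≡0 ∣a-b∣≡0))
  where
  ∣a-b∣<d : ℤ.∣ + a ℤ.- + b ∣ ℕ.< d
  ∣a-b∣<d = subst (ℕ._< d) (cong ℤ.∣_∣ (sym (ℤ.m-n≡m⊖n a b)))
    (ℕ.≤-<-trans (ℤ.∣m⊝n∣≤m⊔n a b) (ℕ.⊔-pres-<m a<d b<d))
  ∣a-b∣≡0 : ℤ.∣ + a ℤ.- + b ∣ ≡ 0
  ∣a-b∣≡0 with ℤ.∣ + a ℤ.- + b ∣ | ∣a-b∣<d | ℤ.∣⇒∣ᵤ d∣a-b
  ... | zero  | _   | _   = refl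
  ... | suc m | m<d | d∣m = ⊥-elim (ℕ.<⇒≱ m<d (ℕ.∣⇒≤ d∣m))

module _ {p : ℕ} (p-prime : Prime p) where

  private instance
    p≢0 : ℕ.NonZero p
    p≢0 = prime⇒nonZero p-prime

  -- Of the pᵏ combinations with coefficients in {0, …, p - 1}, two agree modulo p in all D < k
  -- coordinates; their difference is a relation among the k rows.
  independent⇒≤rank : ∀ {X : Set} {D n k} {K : Kernel X} → LowRank D K → (w : Fin n → X) (rows : Fin k → Fin n) →
    LinearlyIndependent (𝔽 p p-prime) (λ i j → K (w (rows i)) (w j)) → k ℕ.≤ D
  independent⇒≤rank {D = D} {k = k} {K} low w rows independent with k ℕ.≤? D
  ... | yes k≤D = k≤D
  ... | no  k≰D = ⊥-elim (ℕ.<⇒≢ c<c′ (cong toℕ (finToFun-injective {k} {p} λ i →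
    Fin.toℕ-injective (∣-⇒≡ (Fin.toℕ<n _) (Fin.toℕ<n _)
      (subst (+ p ℤ.∣_) (ℤ.+-identityʳ (α i)) (_≈ₚ_.divides-difference (independent α relation i)))))))
    where
    open ≡-Reasoning
    factorisation = lowRank-factor low
    φ = proj₁ factorisation
    ψ = proj₁ (proj₂ factorisation)
    K≡ = proj₂ (proj₂ factorisation)
    v : Fin k → Fin D → ℤ
    v i l = φ l (w (rows i))
    digit : Fin (p ℕ.^ k) → Fin k → ℤ
    digit c i = + toℕ (finToFun {p} {k} c i)
    value : Fin (p ℕ.^ k) → Fin D → ℤ
    value c l = ∑ℤ.sum (λ i → digit c i ℤ.* v i l)
    residue : ℤ → Fin p
    residue z = fromℕ< (ℤ.n%ℕd<d z p)
    collision = Fin.pigeonhole (ℕ.^-monoʳ-< p (ℕ.nonTrivial⇒n>1 p {{prime⇒nonTrivial p-prime}}) (ℕ.≰⇒> k≰D))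
      (λ c → funToFin (λ l → residue (value c l)))
    c  = proj₁ collision
    c′ = proj₁ (proj₂ collision)
    c<c′ = proj₁ (proj₂ (proj₂ collision))
    α : Fin k → ℤ
    α i = digit c i ℤ.- digit c′ i
    value≡ : ∀ l → value c l ℤ.%ℕ p ≡ value c′ l ℤ.%ℕ p
    value≡ l = begin
      value c l ℤ.%ℕ p             ≡⟨ Fin.toℕ-fromℕ< _ ⟨
      toℕ (residue (value c l))    ≡⟨ cong toℕ (trans (sym (Fin.finToFun-funToFin _ l))
                                       (trans (cong (λ z → finToFun {p} {D} z l) (proj₂ (proj₂ (proj₂ collision))))
                                         (Fin.finToFun-funToFin _ l))) ⟩
      toℕ (residue (value c′ l))   ≡⟨ Fin.toℕ-fromℕ< _ ⟩
      value c′ l ℤ.%ℕ p            ∎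
    vanishes : ∀ l → + p ℤ.∣ ∑ℤ.sum (λ i → α i ℤ.* v i l)
    vanishes l = subst (+ p ℤ.∣_) (sym (begin
      ∑ℤ.sum (λ i → α i ℤ.* v i l)
        ≡⟨ ∑ℤ.sum-cong-≗ (λ i → ℤ.*-distribʳ-+ (v i l) (digit c i) (ℤ.- digit c′ i)) ⟩
      ∑ℤ.sum (λ i → digit c i ℤ.* v i l ℤ.+ ℤ.- digit c′ i ℤ.* v i l)
        ≡⟨ ∑ℤ.∑-distrib-+ (λ i → digit c i ℤ.* v i l) _ ⟩
      value c l ℤ.+ ∑ℤ.sum (λ i → ℤ.- digit c′ i ℤ.* v i l)
        ≡⟨ cong (λ z → value c l ℤ.+ z) (trans (∑ℤ.sum-cong-≗ (λ i →
             trans (sym (ℤ.neg-distribˡ-* (digit c′ i) (v i l))) (sym (ℤ.-1*i≡-i _))))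
             (trans (sym (∑ℤ.*-distribˡ-sum ℤ.-1ℤ (λ i → digit c′ i ℤ.* v i l))) (ℤ.-1*i≡-i _))) ⟩
      value c l ℤ.- value c′ l ∎)) (%ℕ≡⇒∣- (value c l) (value c′ l) p (value≡ l))
    relation : ∀ j → _≈ₚ_ p (∑ℤ.sum (λ i → α i ℤ.* K (w (rows i)) (w j))) (+ 0)
    relation j = mk≈ (subst (+ p ℤ.∣_) (sym (begin
      ∑ℤ.sum (λ i → α i ℤ.* K (w (rows i)) (w j)) ℤ.- + 0
        ≡⟨ ℤ.+-identityʳ _ ⟩
      ∑ℤ.sum (λ i → α i ℤ.* K (w (rows i)) (w j))
        ≡⟨ ∑ℤ.sum-cong-≗ (λ i → trans (cong (λ z → α i ℤ.* z) (K≡ (w (rows i)) (w j)))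
             (∑ℤ.*-distribˡ-sum (α i) (λ l → v i l ℤ.* ψ l (w j)))) ⟩
      ∑ℤ.sum (λ i → ∑ℤ.sum (λ l → α i ℤ.* (v i l ℤ.* ψ l (w j))))
        ≡⟨ ∑ℤ.∑-comm (λ i l → α i ℤ.* (v i l ℤ.* ψ l (w j))) ⟩
      ∑ℤ.sum (λ l → ∑ℤ.sum (λ i → α i ℤ.* (v i l ℤ.* ψ l (w j))))
        ≡⟨ ∑ℤ.sum-cong-≗ (λ l → trans
             (∑ℤ.sum-cong-≗ (λ i → sym (ℤ.*-assoc (α i) (v i l) (ψ l (w j)))))
             (sym (∑ℤ.*-distribʳ-sum (ψ l (w j)) (λ i → α i ℤ.* v i l)))) ⟩
      ∑ℤ.sum (λ l → ∑ℤ.sum (λ i → α i ℤ.* v i l) ℤ.* ψ l (w j)) ∎))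
      (∣-∑ _ (λ l → ℤ.∣m⇒∣m*n (ψ l (w j)) (vanishes l))))

  -- Euclid's lemma assigns the factors `p` one at a time: each goes to `u`, until one falls to `v`.
  p^e∣*⇒ : ∀ e u v → p ℕ.^ e ℕ.∣ u ℕ.* v → p ℕ.∣ v ⊎ p ℕ.^ e ℕ.∣ u
  p^e∣*⇒ zero    u v _ = inj₂ (ℕ.1∣ u)
  p^e∣*⇒ (suc e) u v h with euclidsLemma u v p-prime (ℕ.∣-trans (ℕ.m∣m*n (p ℕ.^ e)) h)
  ... | inj₂ p∣v = inj₁ p∣v
  ... | inj₁ (ℕ.divides u′ refl) with p^e∣*⇒ e u′ v (ℕ.*-cancelˡ-∣ p
          (subst (p ℕ.* p ℕ.^ e ℕ.∣_) (trans (cong (ℕ._* v) (ℕ.*-comm u′ p)) (ℕ.*-assoc p u′ v)) h))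
  ...   | inj₁ p∣v    = inj₁ p∣v
  ...   | inj₂ p^e∣u′ = inj₂ (subst (p ℕ.* p ℕ.^ e ℕ.∣_) (ℕ.*-comm p u′) (ℕ.*-monoʳ-∣ p p^e∣u′))

  -- Put `q = h + 1`. By absorption `q` divides `(d + q) C(d + h, h)`. If `p` did not divide the
  -- binomial, all of `q = p ^ e` would divide `d + q`, and hence `d`.
  p∣C : ∀ e h d → p ℕ.^ e ≡ suc h → ¬ suc h ℕ.∣ d → p ℕ.∣ (d ℕ.+ h) C h
  p∣C e h d eq q∤d with p^e∣*⇒ e (suc (d ℕ.+ h)) ((d ℕ.+ h) C h)
    (subst₂ ℕ._∣_ (sym eq) (C-absorb (d ℕ.+ h) h) (ℕ.m∣m*n (suc (d ℕ.+ h) C suc h)))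
  ... | inj₁ p∣c = p∣c
  ... | inj₂ q∣  = ⊥-elim (q∤d (ℕ.∣m+n∣m⇒∣n (subst₂ ℕ._∣_ eq (trans (sym (ℕ.+-suc d h)) (ℕ.+-comm d (suc h))) q∣) ℕ.∣-refl))

-- Minrank of the word graph.

module _ {c ℓ₁ ℓ₂} (F : HeytingField c ℓ₁ ℓ₂) where
  open HeytingField F using (Carrier)

  -- Existence of the rank is only needed to prove an inequality, so its double negation suffices.
  ¬¬hasRank : ∀ {n} (B : Matrix Carrier n) D →
    (∀ k (rows : Fin k → Fin n) → LinearlyIndependent F (λ i → B (rows i)) → k ℕ.≤ D) →
    ¬ ¬ (∃[ r ] r ℕ.≤ D × HasRank F B r)
  ¬¬hasRank B zero bound none =
    none (0 , ℕ.z≤n , record { attained = (λ ()) , (λ _ _ ()) ; maximal = bound })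
  ¬¬hasRank B (suc D) bound none = ¬¬hasRank B D smaller
    λ (r , r≤D , rank) → none (r , ℕ.m≤n⇒m≤1+n r≤D , rank)
    where
    smaller : ∀ k (rows : Fin k → Fin _) → LinearlyIndependent F (λ i → B (rows i)) → k ℕ.≤ D
    smaller k rows independent = ℕ.≤-pred (ℕ.≤∧≢⇒< (bound k rows independent)
      λ { refl → none (suc D , ℕ.≤-refl , record { attained = rows , independent ; maximal = bound }) })

  -- What is known about `B` is a bound on its independent rows, not its rank. The goal is a
  -- decidable inequality, so a rank that exists up to double negation is enough.
  minrank≤ : ∀ {n m D} {G : Graph n} (B : Matrix Carrier n) → IsMinrank F G m → Represents F B G →
    (∀ k (rows : Fin k → Fin n) → LinearlyIndependent F (λ i → B (rows i)) → k ℕ.≤ D) → m ℕ.≤ D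
  minrank≤ {m = m} {D} B isMinrank represents bound = decidable-stable (m ℕ.≤? D) λ m≰D →
    ¬¬hasRank B D bound λ (r , r≤D , rank) →
      m≰D (ℕ.≤-trans (IsMinrank.minimal isMinrank B r represents rank) r≤D)

word : ∀ {r s} → Fin (r ℕ.^ s) → Word r s
word {r} {s} = finToFun {r} {s}

wordGraph : ∀ r s (q : ℕ) → Graph (r ℕ.^ s)
wordGraph r s q = record
  { Edge   = λ i j → ¬ i ≡ j × q ℕ.∣ disagree (word {r} {s} i) (word j)
  ; edge?  = λ i j → ¬? (i Fin.≟ j) ×-dec (q ℕ.∣? disagree (word {r} {s} i) (word j))
  ; symm   = λ {i} {j} (i≢j , q∣d) → i≢j ∘ sym , subst (q ℕ.∣_) (disagree-sym (word {r} {s} i) (word j)) q∣d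
  ; irrefl = λ i≡j (i≢j , _) → i≢j i≡j
  }

wordGraph-minrank≤ : ∀ {p} (p-prime : Prime p) e h r s m → .{{ℕ.NonZero r}} → p ℕ.^ e ≡ suc h →
  IsMinrank (𝔽 p p-prime) (wordGraph r s (suc h)) m → m ℕ.≤ 2 ℕ.^ s ℕ.* r ℕ.^ h
wordGraph-minrank≤ {p} p-prime e h r s m eq isMinrank = ℕ.≤-trans
  (minrank≤ (𝔽 p p-prime) (λ i j → K (w i) (w j)) isMinrank represents
    (λ k → independent⇒≤rank p-prime (lowRank-binomial s h h) w))
  (binomialRank≤ r s h)
  where
  w : Fin (r ℕ.^ s) → Word r s
  w = word
  K : Kernel (Word r s)
  K x y = + ((disagree x y ℕ.+ h) C h)
  represents : Represents (𝔽 p p-prime) (λ i j → K (w i) (w j)) (wordGraph r s (suc h))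
  represents = record
    { diagonal = λ i K≈0 → ℕ.<⇒≱ (ℕ.nonTrivial⇒n>1 p {{prime⇒nonTrivial p-prime}})
        (ℕ.∣⇒≤ (subst (p ℕ.∣_) (trans (cong (λ d → (d ℕ.+ h) C h) (disagree-refl (w i))) (nCn≡1 h))
          (ℤ.∣⇒∣ᵤ (subst (+ p ℤ.∣_) (ℤ.+-identityʳ (K (w i) (w i))) (_≈ₚ_.divides-difference K≈0)))))
    ; nonEdge = λ i j i≢j nonEdge → mk≈ (subst (+ p ℤ.∣_) (sym (ℤ.+-identityʳ (K (w i) (w j))))
        (ℤ.∣ᵤ⇒∣ (p∣C p-prime e h (disagree (w i) (w j)) eq (λ q∣d → nonEdge (i≢j , q∣d)))))
    }

-- Rational arithmetic and quadratic forms.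

ι : ℤ → ℚ
ι z = z ℚ./ 1

-- Identities for `ι` are checked on unnormalised rationals, where no common factors are cancelled.
toℚᵘ-ι : ∀ z → toℚᵘ (ι z) ℚᵘ.≃ ℚᵘ.mkℚᵘ z 0
toℚᵘ-ι z = ℚ.toℚᵘ-fromℚᵘ (ℚᵘ.mkℚᵘ z 0)

ι-+ : ∀ a b → ι (a ℤ.+ b) ≡ ι a ℚ.+ ι b
ι-+ a b = ℚ.toℚᵘ-injective (ℚᵘ.≃-trans (toℚᵘ-ι (a ℤ.+ b)) (ℚᵘ.≃-trans
  (ℚᵘ.*≡* (cong (ℤ._* + 1) (sym (cong₂ ℤ._+_ (ℤ.*-identityʳ a) (ℤ.*-identityʳ b)))))
  (ℚᵘ.≃-sym (ℚᵘ.≃-trans (ℚ.toℚᵘ-homo-+ (ι a) (ι b)) (ℚᵘ.+-cong (toℚᵘ-ι a) (toℚᵘ-ι b))))))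

ι-* : ∀ a b → ι (a ℤ.* b) ≡ ι a ℚ.* ι b
ι-* a b = ℚ.toℚᵘ-injective (ℚᵘ.≃-trans (toℚᵘ-ι (a ℤ.* b))
  (ℚᵘ.≃-sym (ℚᵘ.≃-trans (ℚ.toℚᵘ-homo-* (ι a) (ι b)) (ℚᵘ.*-cong (toℚᵘ-ι a) (toℚᵘ-ι b)))))

ι-mono : ∀ {a b} → a ℤ.≤ b → ι a ℚ.≤ ι b
ι-mono {a} {b} a≤b = ℚ.toℚᵘ-cancel-≤ (ℚᵘ.≤-trans (ℚᵘ.≤-reflexive (toℚᵘ-ι a)) (ℚᵘ.≤-trans
  (ℚᵘ.*≤* (ℤ.*-monoʳ-≤-nonNeg (+ 1) a≤b)) (ℚᵘ.≤-reflexive (ℚᵘ.≃-sym (toℚᵘ-ι b)))))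

0≤ι : ∀ n → 0ℚ ℚ.≤ ι (+ n)
0≤ι n = ι-mono {+ 0} {+ n} (ℤ.+≤+ ℕ.z≤n)

*-nonNeg : ∀ {a b} → 0ℚ ℚ.≤ a → 0ℚ ℚ.≤ b → 0ℚ ℚ.≤ a ℚ.* b
*-nonNeg {a} {b} 0≤a 0≤b = ℚ.nonNegative⁻¹ (a ℚ.* b)
  {{ℚ.nonNeg*nonNeg⇒nonNeg a {{ℚ.nonNegative 0≤a}} b {{ℚ.nonNegative 0≤b}}}}

*-monoˡ : ∀ {a b c} → 0ℚ ℚ.≤ c → a ℚ.≤ b → c ℚ.* a ℚ.≤ c ℚ.* b
*-monoˡ {c = c} 0≤c = ℚ.*-monoˡ-≤-nonNeg c {{ℚ.nonNegative 0≤c}}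

*-mono : ∀ {a b c d} → 0ℚ ℚ.≤ a → 0ℚ ℚ.≤ d → a ℚ.≤ b → c ℚ.≤ d → a ℚ.* c ℚ.≤ b ℚ.* d
*-mono {a} {d = d} 0≤a 0≤d a≤b c≤d =
  ℚ.≤-trans (*-monoˡ 0≤a c≤d) (ℚ.*-monoʳ-≤-nonNeg d {{ℚ.nonNegative 0≤d}} a≤b)

*-pos : ∀ {a b} → 0ℚ ℚ.< a → 0ℚ ℚ.< b → 0ℚ ℚ.< a ℚ.* b
*-pos {a} {b} 0<a 0<b = subst (ℚ._< a ℚ.* b) (ℚ.*-zeroʳ a) (ℚ.*-monoʳ-<-pos a {{ℚ.positive 0<a}} 0<b)

0≤x² : ∀ x → 0ℚ ℚ.≤ x ℚ.* x
0≤x² x with ℚ.≤-total 0ℚ x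
... | inj₁ 0≤x = *-nonNeg 0≤x 0≤x
... | inj₂ x≤0 = subst (0ℚ ℚ.≤_) (solve 1 (λ x → (:- x) :* (:- x) := x :* x) refl x) (*-nonNeg 0≤-x 0≤-x)
  where
  open ℚ.+-*-Solver
  0≤-x : 0ℚ ℚ.≤ ℚ.- x
  0≤-x = ℚ.neg-antimono-≤ x≤0

x≤x+y : ∀ {x y} → 0ℚ ℚ.≤ y → x ℚ.≤ x ℚ.+ y
x≤x+y {x} {y} 0≤y = subst (ℚ._≤ x ℚ.+ y) (ℚ.+-identityʳ x) (ℚ.+-monoʳ-≤ x 0≤y)

reciprocal : ∀ {a} → 0ℚ ℚ.< a → ∃[ b ] 0ℚ ℚ.< b × b ℚ.* a ≡ 1ℚ
reciprocal {a} 0<a = ℚ.1/ a , ℚ.positive⁻¹ (ℚ.1/ a) {{ℚ.1/pos⇒pos a}} , ℚ.*-inverseˡ a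
  where
  instance
    a-pos : ℚ.Positive a
    a-pos = ℚ.positive 0<a
    a≢0 : ℚ.NonZero a
    a≢0 = ℚ.pos⇒nonZero a

0<ι : ∀ n → .{{ℕ.NonZero n}} → 0ℚ ℚ.< ι (+ n)
0<ι (suc n) = ℚ.<-≤-trans (ℚ.positive⁻¹ 1ℚ) (ι-mono {+ 1} {+ suc n} (ℤ.+≤+ (ℕ.s≤s ℕ.z≤n)))

∑-const : ∀ n c → ∑ℚ.sum {n} (λ _ → c) ≡ ι (+ n) ℚ.* c
∑-const zero    c = sym (ℚ.*-zeroˡ c)
∑-const (suc n) c = begin
  c ℚ.+ ∑ℚ.sum {n} (λ _ → c)     ≡⟨ cong (c ℚ.+_) (∑-const n c) ⟩
  c ℚ.+ ι (+ n) ℚ.* c            ≡⟨ solve 2 (λ n c → c :+ n :* c := (con 1ℚ :+ n) :* c) refl (ι (+ n)) c ⟩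
  (1ℚ ℚ.+ ι (+ n)) ℚ.* c         ≡⟨ cong (ℚ._* c) (ι-+ (+ 1) (+ n)) ⟨
  ι (+ suc n) ℚ.* c              ∎
  where
  open ≡-Reasoning
  open ℚ.+-*-Solver

∑∑-distrib-+ : ∀ {m n} (f g : Fin m → Fin n → ℚ) →
  ∑ℚ.sum (λ i → ∑ℚ.sum (λ j → f i j ℚ.+ g i j)) ≡
  ∑ℚ.sum (λ i → ∑ℚ.sum (f i)) ℚ.+ ∑ℚ.sum (λ i → ∑ℚ.sum (g i))
∑∑-distrib-+ f g = trans (∑ℚ.sum-cong-≗ (λ i → ∑ℚ.∑-distrib-+ (f i) (g i)))
  (∑ℚ.∑-distrib-+ (λ i → ∑ℚ.sum (f i)) (λ i → ∑ℚ.sum (g i)))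

∑∑-scale : ∀ {m n} c (f : Fin m → Fin n → ℚ) →
  ∑ℚ.sum (λ i → ∑ℚ.sum (λ j → c ℚ.* f i j)) ≡ c ℚ.* ∑ℚ.sum (λ i → ∑ℚ.sum (f i))
∑∑-scale c f = sym (trans (∑ℚ.*-distribˡ-sum c (λ i → ∑ℚ.sum (f i)))
  (∑ℚ.sum-cong-≗ (λ i → ∑ℚ.*-distribˡ-sum c (f i))))

∑∑-cong : ∀ {m n} {f g : Fin m → Fin n → ℚ} → (∀ i j → f i j ≡ g i j) →
  ∑ℚ.sum (λ i → ∑ℚ.sum (f i)) ≡ ∑ℚ.sum (λ i → ∑ℚ.sum (g i))
∑∑-cong e = ∑ℚ.sum-cong-≗ (λ i → ∑ℚ.sum-cong-≗ (e i))

quadraticForm : ∀ {n} → (Fin n → Fin n → ℚ) → (Fin n → ℚ) → ℚ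
quadraticForm B x = ∑ℚ.sum λ i → ∑ℚ.sum λ j → x i ℚ.* B i j ℚ.* x j

-- A square contributes a natural multiple of `(∑ x i φ(w i))²`, and sums of kernels add their
-- forms. The map `w` turns a kernel into a matrix indexed by vertices.
gram-nonNeg : ∀ {X : Set} {K : Kernel X} → Gram K → ∀ {n} (w : Fin n → X) (x : Fin n → ℚ) →
  0ℚ ℚ.≤ quadraticForm (λ i j → ι (K (w i) (w j))) x
gram-nonNeg {K = K} (square v φ e) {n} w x = subst (0ℚ ℚ.≤_) (sym (begin
  quadraticForm (λ i j → ι (K (w i) (w j))) x
    ≡⟨ ∑∑-cong (λ i j → trans (cong (λ z → x i ℚ.* z ℚ.* x j) (entry i j))
         (solve 5 (λ a b v c d → a :* (v :* (c :* d)) :* b := v :* ((a :* c) :* (b :* d))) refl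
           (x i) (x j) (ι (+ v)) (ι (φ (w i))) (ι (φ (w j))))) ⟩
  ∑ℚ.sum (λ i → ∑ℚ.sum (λ j → ι (+ v) ℚ.* (y i ℚ.* y j)))
    ≡⟨ ∑∑-scale (ι (+ v)) (λ i j → y i ℚ.* y j) ⟩
  ι (+ v) ℚ.* ∑ℚ.sum (λ i → ∑ℚ.sum (λ j → y i ℚ.* y j))
    ≡⟨ cong (ι (+ v) ℚ.*_) (trans
         (∑ℚ.sum-cong-≗ (λ i → sym (∑ℚ.*-distribˡ-sum (y i) y)))
         (sym (∑ℚ.*-distribʳ-sum (∑ℚ.sum y) y))) ⟩
  ι (+ v) ℚ.* (∑ℚ.sum y ℚ.* ∑ℚ.sum y) ∎))
  (*-nonNeg (0≤ι v) (0≤x² (∑ℚ.sum y)))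
  where
  open ≡-Reasoning
  open ℚ.+-*-Solver
  y : Fin n → ℚ
  y i = x i ℚ.* ι (φ (w i))
  entry : ∀ i j → ι (K (w i) (w j)) ≡ ι (+ v) ℚ.* (ι (φ (w i)) ℚ.* ι (φ (w j)))
  entry i j = trans (cong ι (e (w i) (w j)))
    (trans (ι-* (+ v) _) (cong (ι (+ v) ℚ.*_) (ι-* (φ (w i)) (φ (w j)))))
gram-nonNeg {K = K} (plus {L} {M} g h e) w x = subst (0ℚ ℚ.≤_) (sym (begin
  quadraticForm (λ i j → ι (K (w i) (w j))) x
    ≡⟨ ∑∑-cong (λ i j → trans
         (cong (λ z → x i ℚ.* z ℚ.* x j) (trans (cong ι (e (w i) (w j))) (ι-+ (L (w i) (w j)) (M (w i) (w j)))))
         (solve 4 (λ a l m b → a :* (l :+ m) :* b := a :* l :* b :+ a :* m :* b) refl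
           (x i) (ι (L (w i) (w j))) (ι (M (w i) (w j))) (x j))) ⟩
  ∑ℚ.sum (λ i → ∑ℚ.sum (λ j → x i ℚ.* ι (L (w i) (w j)) ℚ.* x j ℚ.+ x i ℚ.* ι (M (w i) (w j)) ℚ.* x j))
    ≡⟨ ∑∑-distrib-+ (λ i j → x i ℚ.* ι (L (w i) (w j)) ℚ.* x j) _ ⟩
  quadraticForm (λ i j → ι (L (w i) (w j))) x ℚ.+ quadraticForm (λ i j → ι (M (w i) (w j))) x ∎))
  (ℚ.+-mono-≤ (gram-nonNeg g w x) (gram-nonNeg h w x))
  where
  open ≡-Reasoning
  open ℚ.+-*-Solver

-- Powers of rationals.

^-nonNeg : ∀ {u} k → 0ℚ ℚ.≤ u → 0ℚ ℚ.≤ u ^ k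
^-nonNeg zero    0≤u = ℚ.nonNegative⁻¹ 1ℚ
^-nonNeg (suc k) 0≤u = *-nonNeg 0≤u (^-nonNeg k 0≤u)

^-pos : ∀ {u} k → 0ℚ ℚ.< u → 0ℚ ℚ.< u ^ k
^-pos zero    0<u = ℚ.positive⁻¹ 1ℚ
^-pos (suc k) 0<u = *-pos 0<u (^-pos k 0<u)

^-mono : ∀ {u v} k → 0ℚ ℚ.≤ u → u ℚ.≤ v → u ^ k ℚ.≤ v ^ k
^-mono zero    0≤u u≤v = ℚ.≤-refl
^-mono (suc k) 0≤u u≤v = *-mono 0≤u (^-nonNeg k (ℚ.≤-trans 0≤u u≤v)) u≤v (^-mono k 0≤u u≤v)

-- Multiply the inductive bound by `u + v` and drop the two nonnegative cross terms. The exponent is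
-- a successor because the claim at exponent 0 would be `2 ≤ 1`.
^-superadditive : ∀ {u v} k → 0ℚ ℚ.≤ u → 0ℚ ℚ.≤ v → u ^ suc k ℚ.+ v ^ suc k ℚ.≤ (u ℚ.+ v) ^ suc k
^-superadditive {u} {v} zero 0≤u 0≤v =
  ℚ.≤-reflexive (solve 2 (λ u v → u :* con 1ℚ :+ v :* con 1ℚ := (u :+ v) :* con 1ℚ) refl u v)
  where open ℚ.+-*-Solver
^-superadditive {u} {v} (suc k) 0≤u 0≤v = ℚ.≤-trans
  (ℚ.≤-trans
    (x≤x+y (ℚ.+-mono-≤ (*-nonNeg 0≤u (^-nonNeg (suc k) 0≤v)) (*-nonNeg 0≤v (^-nonNeg (suc k) 0≤u))))
    (ℚ.≤-reflexive (solve 4 (λ u v a b → (u :* a :+ v :* b) :+ (u :* b :+ v :* a) := (u :+ v) :* (a :+ b)) refl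
      u v (u ^ suc k) (v ^ suc k))))
  (*-monoˡ (ℚ.+-mono-≤ 0≤u 0≤v) (^-superadditive k 0≤u 0≤v))
  where open ℚ.+-*-Solver

ι-^ : ∀ m k → ι (+ (m ℕ.^ k)) ≡ ι (+ m) ^ k
ι-^ m zero    = refl
ι-^ m (suc k) = trans (cong ι (ℤ.pos-* m (m ℕ.^ k))) (trans (ι-* (+ m) (+ (m ℕ.^ k))) (cong (ι (+ m) ℚ.*_) (ι-^ m k)))

-- Inequalities between real numbers.

½+½ : ∀ δ → ½ ℚ.* δ ℚ.+ ½ ℚ.* δ ≡ δ
½+½ δ = trans (sym (ℚ.*-distribʳ-+ δ ½ ½)) (ℚ.*-identityˡ δ)

0<½* : ∀ {δ} → 0ℚ ℚ.< δ → 0ℚ ℚ.< ½ ℚ.* δ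
0<½* = *-pos (ℚ.positive⁻¹ ½)

-- The operations on reals act index by index, so most of the real inequalities below can be checked
-- on rational approximations.
≤ℝ-pointwise : ∀ x y → (∀ k → approx x k ℚ.≤ approx y k) → x ≤ℝ y
≤ℝ-pointwise x y h = mk≤ λ δ δ>0 → 0 , λ k _ → ℚ.≤-trans (h k) (x≤x+y (ℚ.<⇒≤ δ>0))

≃ℝ-pointwise : ∀ x y → (∀ k → approx x k ≡ approx y k) → x ≃ℝ y
≃ℝ-pointwise x y h = ≤ℝ-pointwise x y (λ k → ℚ.≤-reflexive (h k)) ,
                     ≤ℝ-pointwise y x (λ k → ℚ.≤-reflexive (sym (h k)))

≤ℝ-trans : ∀ {x y z} → x ≤ℝ y → y ≤ℝ z → x ≤ℝ z
≤ℝ-trans {x} {y} {z} (mk≤ f) (mk≤ g) = mk≤ λ δ δ>0 →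
  let (M , f′) = f (½ ℚ.* δ) (0<½* δ>0) ; (N , g′) = g (½ ℚ.* δ) (0<½* δ>0) in
  M ℕ.⊔ N , λ n h → ℚ.≤-trans (f′ n (ℕ.≤-trans (ℕ.m≤m⊔n M N) h)) (ℚ.≤-trans
    (ℚ.+-monoˡ-≤ (½ ℚ.* δ) (g′ n (ℕ.≤-trans (ℕ.m≤n⊔m M N) h)))
    (ℚ.≤-reflexive (trans (ℚ.+-assoc (approx z n) _ _) (cong (approx z n ℚ.+_) (½+½ δ)))))

≤ℝ-scale : ∀ y z w μ → 0ℚ ℚ.≤ w → y ≤ℝ fromℚ μ → (∀ k → approx z k ≡ w ℚ.* approx y k) → z ≤ℝ fromℚ (w ℚ.* μ)
≤ℝ-scale y z w μ 0≤w (mk≤ f) z≡wy = mk≤ bound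
  where
  -- The error `δ / (1 + w)` stays below `δ` after multiplication by `w`, and the denominator is
  -- positive even for `w = 0`.
  inv = reciprocal {1ℚ ℚ.+ w} (ℚ.<-≤-trans (ℚ.positive⁻¹ 1ℚ) (x≤x+y 0≤w))
  r = proj₁ inv
  bound : ∀ δ → 0ℚ ℚ.< δ → ∃[ N ] ∀ n → N ℕ.≤ n → approx z n ℚ.≤ w ℚ.* μ ℚ.+ δ
  bound δ δ>0 = proj₁ (f (r ℚ.* δ) rδ>0) , λ n h → let open ℚ.≤-Reasoning in begin
    approx z n                     ≡⟨ z≡wy n ⟩
    w ℚ.* approx y n               ≤⟨ *-monoˡ 0≤w (proj₂ (f (r ℚ.* δ) rδ>0) n h) ⟩
    w ℚ.* (μ ℚ.+ r ℚ.* δ)          ≤⟨ x≤x+y (ℚ.<⇒≤ rδ>0) ⟩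
    w ℚ.* (μ ℚ.+ r ℚ.* δ) ℚ.+ r ℚ.* δ ≡⟨ collect w μ r δ ⟩
    w ℚ.* μ ℚ.+ r ℚ.* (1ℚ ℚ.+ w) ℚ.* δ ≡⟨ cong (λ t → w ℚ.* μ ℚ.+ t ℚ.* δ) (proj₂ (proj₂ inv)) ⟩
    w ℚ.* μ ℚ.+ 1ℚ ℚ.* δ           ≡⟨ cong (w ℚ.* μ ℚ.+_) (ℚ.*-identityˡ δ) ⟩
    w ℚ.* μ ℚ.+ δ                  ∎
    where
    open ℚ.+-*-Solver
    rδ>0 : 0ℚ ℚ.< r ℚ.* δ
    rδ>0 = *-pos (proj₁ (proj₂ inv)) δ>0
    collect : ∀ w μ r δ → w ℚ.* (μ ℚ.+ r ℚ.* δ) ℚ.+ r ℚ.* δ ≡ w ℚ.* μ ℚ.+ r ℚ.* (1ℚ ℚ.+ w) ℚ.* δ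
    collect = solve 4 (λ w μ r δ → w :* (μ :+ r :* δ) :+ r :* δ := w :* μ :+ r :* (con 1ℚ :+ w) :* δ) refl

approx-^ : ∀ y k n → approx (y ^ℝ k) n ≡ approx y n ^ k
approx-^ y zero    n = refl
approx-^ y (suc k) n = cong (approx y n ℚ.*_) (approx-^ y k n)

approx-∑ : ∀ {m} (v : Vector ℝ m) n → approx (sumℝ v) n ≡ ∑ℚ.sum (λ i → approx (v i) n)
approx-∑ {zero}  v n = refl
approx-∑ {suc m} v n = cong (approx (v zero) n ℚ.+_) (approx-∑ (v ∘ suc) n)

approx-∑∑ : ∀ {m l} (v : Fin m → Vector ℝ l) n →
  approx (sumℝ λ i → sumℝ (v i)) n ≡ ∑ℚ.sum (λ i → ∑ℚ.sum (λ j → approx (v i j) n))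
approx-∑∑ v n = trans (approx-∑ (λ i → sumℝ (v i)) n) (∑ℚ.sum-cong-≗ (λ i → approx-∑ (v i) n))

-- An approximation above `M + δ` would have its power at least `M ^ suc h + δ ^ suc h` by
-- superadditivity, while the hypothesis is used with only half of `δ ^ suc h` as tolerance. No root
-- is constructed.
^ℝ-cancel-≤ : ∀ y M h → y ^ℝ suc h ≤ℝ fromℕ (M ℕ.^ suc h) → y ≤ℝ fromℕ M
^ℝ-cancel-≤ y M h (mk≤ f) = mk≤ λ δ δ>0 →
  let η>0 = 0<½* (^-pos (suc h) δ>0) ; (N , f′) = f (½ ℚ.* δ ^ suc h) η>0 in
  N , λ n N≤n → case n δ δ>0 (f′ n N≤n)
  where
  μ = ι (+ M)
  case : ∀ n δ → 0ℚ ℚ.< δ → approx (y ^ℝ suc h) n ℚ.≤ ι (+ (M ℕ.^ suc h)) ℚ.+ ½ ℚ.* δ ^ suc h →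
         approx y n ℚ.≤ μ ℚ.+ δ
  case n δ δ>0 small with approx y n ℚ.≤? μ ℚ.+ δ
  ... | yes y≤ = y≤
  ... | no  y≰ = contradiction (ℚ.<-≤-trans (begin-strict
    ι (+ (M ℕ.^ suc h)) ℚ.+ η  ≡⟨ cong (ℚ._+ η) (ι-^ M (suc h)) ⟩
    μ ^ suc h ℚ.+ η            <⟨ ℚ.+-monoʳ-< (μ ^ suc h) η<δ^ ⟩
    μ ^ suc h ℚ.+ δ ^ suc h    ≤⟨ ^-superadditive h (0≤ι M) (ℚ.<⇒≤ δ>0) ⟩
    (μ ℚ.+ δ) ^ suc h          ≤⟨ ^-mono (suc h) (ℚ.+-mono-≤ (0≤ι M) (ℚ.<⇒≤ δ>0)) (ℚ.<⇒≤ (ℚ.≰⇒> y≰)) ⟩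
    approx y n ^ suc h         ≡⟨ approx-^ y (suc h) n ⟨
    approx (y ^ℝ suc h) n      ∎) small) (ℚ.<-irrefl refl)
    where
    open ℚ.≤-Reasoning
    η = ½ ℚ.* δ ^ suc h
    η<δ^ : η ℚ.< δ ^ suc h
    η<δ^ = subst₂ ℚ._<_ (ℚ.+-identityʳ η) (½+½ (δ ^ suc h)) (ℚ.+-monoʳ-< η (0<½* (^-pos (suc h) δ>0)))

-- The product of the kernels.

-- This is `r` times the kernel of the overview. The multiple makes its nonconstant part `balance`,
-- a sum of integer squares.
factor : ℕ → ℕ → ℕ → ℕ → ℤ
factor r s t a = + r ℤ.* (+ s ℤ.- + t) ℤ.+ balance r s t a

factor-root : ∀ r s t → factor r s t t ≡ + 0
factor-root r s t = trans
  (cong₂ (λ u v → + r ℤ.* (+ s ℤ.- + t) ℤ.+ + r ℤ.* (+ r ℤ.* (+ suc t ℤ.* + u) ℤ.- (+ s ℤ.- + t) ℤ.* + v))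
    (k>n⇒nCk≡0 (ℕ.n<1+n t)) (nCn≡1 t))
  (cancel (+ r) (+ s) (+ t))
  where
  open ℤ.+-*-Solver
  cancel : ∀ r s t → r ℤ.* (s ℤ.- t) ℤ.+ r ℤ.* (r ℤ.* ((+ 1 ℤ.+ t) ℤ.* + 0) ℤ.- (s ℤ.- t) ℤ.* + 1) ≡ + 0
  cancel = solve 3 (λ r s t → r :* (s :- t) :+ r :* (r :* ((con (+ 1) :+ t) :* con (+ 0)) :- (s :- t) :* con (+ 1)) := con (+ 0)) refl

pos-∸ : ∀ {s t} → t ℕ.≤ s → + s ℤ.- + t ≡ + (s ℕ.∸ t)
pos-∸ {s} {t} t≤s = trans (ℤ.m-n≡m⊖n s t) (ℤ.⊖-≥ t≤s)

-- Absorption replaces `(t + 1) C(s, t + 1)` by `(s - t) C(s, t)`, so the constant part `r (s - t)`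
-- factors out. The cofactor is linear in `k = r - 1`.
factor-diagonal : ∀ k s t → t ℕ.≤ s →
  factor (suc k) s t s ≡ + (suc k ℕ.* (s ℕ.∸ t) ℕ.* (1 ℕ.+ k ℕ.* (s C t)))
factor-diagonal k s t t≤s = begin
  factor (suc k) s t s
    ≡⟨ cong (λ z → + suc k ℤ.* Δ ℤ.+ + suc k ℤ.* (+ suc k ℤ.* z ℤ.- Δ ℤ.* + c)) (C-absorbℤ s t) ⟩
  + suc k ℤ.* Δ ℤ.+ + suc k ℤ.* (+ suc k ℤ.* (Δ ℤ.* + c) ℤ.- Δ ℤ.* + c)
    ≡⟨ collect (+ k) Δ (+ c) ⟩
  (+ suc k ℤ.* Δ) ℤ.* (+ 1 ℤ.+ + k ℤ.* + c)
    ≡⟨ cong₂ ℤ._*_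
         (trans (cong (λ z → + suc k ℤ.* z) (pos-∸ t≤s)) (sym (ℤ.pos-* (suc k) (s ℕ.∸ t))))
         (cong (λ z → + 1 ℤ.+ z) (sym (ℤ.pos-* k c))) ⟩
  + (suc k ℕ.* (s ℕ.∸ t)) ℤ.* + (1 ℕ.+ k ℕ.* c)
    ≡⟨ ℤ.pos-* (suc k ℕ.* (s ℕ.∸ t)) (1 ℕ.+ k ℕ.* c) ⟨
  + (suc k ℕ.* (s ℕ.∸ t) ℕ.* (1 ℕ.+ k ℕ.* c)) ∎
  where
  open ≡-Reasoning
  open ℤ.+-*-Solver
  c = s C t
  Δ = + s ℤ.- + t
  collect : ∀ k Δ c → (+ 1 ℤ.+ k) ℤ.* Δ ℤ.+ (+ 1 ℤ.+ k) ℤ.* ((+ 1 ℤ.+ k) ℤ.* (Δ ℤ.* c) ℤ.- Δ ℤ.* c) ≡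
            ((+ 1 ℤ.+ k) ℤ.* Δ) ℤ.* (+ 1 ℤ.+ k ℤ.* c)
  collect = solve 3 (λ k Δ c →
    (con (+ 1) :+ k) :* Δ :+ (con (+ 1) :+ k) :* ((con (+ 1) :+ k) :* (Δ :* c) :- Δ :* c) :=
    ((con (+ 1) :+ k) :* Δ) :* (con (+ 1) :+ k :* c)) refl

factors : ℕ → ℕ → ℕ → ℕ → ℕ → ℤ
factors r s q zero    a = + 1
factors r s q (suc j) a = factors r s q j a ℤ.* factor r s (j ℕ.* q) a

constantPart : ℕ → ℕ → ℕ → ℕ → ℕ
constantPart r s q zero    = 1
constantPart r s q (suc j) = constantPart r s q j ℕ.* (r ℕ.* (s ℕ.∸ j ℕ.* q))

diagonalRatio : ℕ → ℕ → ℕ → ℕ → ℕ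
diagonalRatio k s q zero    = 1
diagonalRatio k s q (suc j) = diagonalRatio k s q j ℕ.* (1 ℕ.+ k ℕ.* (s C (j ℕ.* q)))

factors-root : ∀ r s q j i → i < j → factors r s q j (i ℕ.* q) ≡ + 0
factors-root r s q (suc j) i i<1+j with i ℕ.≟ j
... | yes refl = trans (cong (λ z → factors r s q j (j ℕ.* q) ℤ.* z) (factor-root r s (j ℕ.* q)))
                   (ℤ.*-zeroʳ (factors r s q j (j ℕ.* q)))
... | no  i≢j  = trans (cong (ℤ._* factor r s (j ℕ.* q) (i ℕ.* q))
                   (factors-root r s q j i (ℕ.≤∧≢⇒< (ℕ.≤-pred i<1+j) i≢j)))
                   (ℤ.*-zeroˡ (factor r s (j ℕ.* q) (i ℕ.* q)))

factors-diagonal : ∀ k s q j → j ℕ.* q ℕ.≤ s →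
  factors (suc k) s q j s ≡ + (constantPart (suc k) s q j ℕ.* diagonalRatio k s q j)
factors-diagonal k s q zero    _    = refl
factors-diagonal k s q (suc j) jq≤s = begin
  factors (suc k) s q j s ℤ.* factor (suc k) s (j ℕ.* q) s
    ≡⟨ cong₂ ℤ._*_ (factors-diagonal k s q j j′q≤s) (factor-diagonal k s (j ℕ.* q) j′q≤s) ⟩
  + (P ℕ.* U) ℤ.* + (a ℕ.* b)
    ≡⟨ ℤ.pos-* (P ℕ.* U) (a ℕ.* b) ⟨
  + (P ℕ.* U ℕ.* (a ℕ.* b))
    ≡⟨ cong +_ (solve 4 (λ P U a b → P :* U :* (a :* b) := P :* a :* (U :* b)) refl P U a b) ⟩
  + (P ℕ.* a ℕ.* (U ℕ.* b)) ∎
  where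
  open ≡-Reasoning
  open ℕ.+-*-Solver
  j′q≤s = ℕ.≤-trans (ℕ.m≤n+m (j ℕ.* q) q) jq≤s
  P = constantPart (suc k) s q j
  U = diagonalRatio k s q j
  a = suc k ℕ.* (s ℕ.∸ j ℕ.* q)
  b = 1 ℕ.+ k ℕ.* (s C (j ℕ.* q))

constantPart≢0 : ∀ r s q j → .{{ℕ.NonZero r}} → .{{ℕ.NonZero q}} → j ℕ.* q ℕ.≤ s → ℕ.NonZero (constantPart r s q j)
constantPart≢0 r s q zero    _    = _
constantPart≢0 r s q (suc j) jq≤s = ℕ.m*n≢0 (constantPart r s q j) _
  {{constantPart≢0 r s q j (ℕ.<⇒≤ j′q<s)}} {{ℕ.m*n≢0 r (s ℕ.∸ j ℕ.* q)}}
  where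
  j′q<s : j ℕ.* q < s
  j′q<s = ℕ.<-≤-trans (ℕ.m<n+m (j ℕ.* q) (ℕ.>-nonZero⁻¹ q)) jq≤s
  instance
    Δ≢0 : ℕ.NonZero (s ℕ.∸ j ℕ.* q)
    Δ≢0 = ℕ.>-nonZero (ℕ.m<n⇒0<n∸m j′q<s)

diagonalRatio≢0 : ∀ k s q j → ℕ.NonZero (diagonalRatio k s q j)
diagonalRatio≢0 k s q zero    = _
diagonalRatio≢0 k s q (suc j) = ℕ.m*n≢0 (diagonalRatio k s q j) _ {{diagonalRatio≢0 k s q j}}

-- `2 ^ s` bounds both the binomial and the summand 1, so each of the `j` kernels costs a factor
-- `O(r)` for fixed `s`.
diagonalRatio≤ : ∀ k s q j → diagonalRatio k s q j ℕ.≤ (suc k ℕ.* 2 ℕ.^ s) ℕ.^ j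
diagonalRatio≤ k s q zero    = ℕ.≤-refl
diagonalRatio≤ k s q (suc j) = subst (diagonalRatio k s q (suc j) ℕ.≤_)
  (ℕ.*-comm ((suc k ℕ.* 2 ℕ.^ s) ℕ.^ j) (suc k ℕ.* 2 ℕ.^ s))
  (ℕ.*-mono-≤ (diagonalRatio≤ k s q j)
    (ℕ.+-mono-≤ (ℕ.m^n>0 2 s) (ℕ.*-monoʳ-≤ k (C≤2^ s (j ℕ.* q)))))

-- In `(P + L) (c + b) = P c + (P b + L (c + b))` the bracket is built from positive semidefinite
-- kernels by sums and products, so only the constants remain outside.
factors-gram : ∀ r s q j → j ℕ.* q ℕ.≤ s → ∃[ L ] Gram {Word r s} L ×
  (∀ x y → factors r s q j (agree x y) ≡ + constantPart r s q j ℤ.+ L x y)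
factors-gram r s q zero    _    = _ , gram-const 0 , λ _ _ → refl
factors-gram r s q (suc j) jq≤s with factors-gram r s q j (ℕ.≤-trans (ℕ.m≤n+m (j ℕ.* q) q) jq≤s)
... | L , gL , eL = _ ,
  gram-+ (gram-* (gram-const P) gB) (gram-* gL (gram-+ (gram-const c) gB)) ,
  λ x y → let b = balance r s t (agree x y) in begin
    factors r s q j (agree x y) ℤ.* (+ r ℤ.* (+ s ℤ.- + t) ℤ.+ b)
      ≡⟨ cong₂ (λ u v → u ℤ.* (v ℤ.+ b)) (eL x y)
           (trans (cong (λ z → + r ℤ.* z) (pos-∸ (ℕ.≤-trans (ℕ.m≤n+m t q) jq≤s))) (sym (ℤ.pos-* r (s ℕ.∸ t)))) ⟩
    (+ P ℤ.+ L x y) ℤ.* (+ c ℤ.+ b)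
      ≡⟨ expand (+ P) (L x y) (+ c) b ⟩
    + P ℤ.* + c ℤ.+ (+ P ℤ.* b ℤ.+ L x y ℤ.* (+ c ℤ.+ b))
      ≡⟨ cong (λ z → z ℤ.+ (+ P ℤ.* b ℤ.+ L x y ℤ.* (+ c ℤ.+ b))) (sym (ℤ.pos-* P c)) ⟩
    + (P ℕ.* c) ℤ.+ (+ P ℤ.* b ℤ.+ L x y ℤ.* (+ c ℤ.+ b)) ∎
  where
  open ≡-Reasoning
  open ℤ.+-*-Solver
  t = j ℕ.* q
  c = r ℕ.* (s ℕ.∸ t)
  P = constantPart r s q j
  gB : Gram {Word r s} (λ x y → balance r s t (agree x y))
  gB = gram-balance s t
  expand : ∀ P L c b → (P ℤ.+ L) ℤ.* (c ℤ.+ b) ≡ P ℤ.* c ℤ.+ (P ℤ.* b ℤ.+ L ℤ.* (c ℤ.+ b))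
  expand = solve 4 (λ P L c b → (P :+ L) :* (c :+ b) := P :* c :+ (P :* b :+ L :* (c :+ b))) refl

agree-refl : ∀ {r s} (x : Word r s) → agree x x ≡ s
agree-refl {s = s} x = trans (sym (ℕ.+-identityʳ _))
  (trans (cong (agree x x ℕ.+_) (sym (disagree-refl x))) (agree+disagree x x))

agree-sym : ∀ {r s} (x y : Word r s) → agree x y ≡ agree y x
agree-sym x y = ℕ.+-cancelʳ-≡ (disagree x y) _ _ (trans (agree+disagree x y)
  (sym (trans (cong (agree y x ℕ.+_) (disagree-sym x y)) (agree+disagree y x))))

-- Agreements and disagreements add up to `j q`, so `q` divides both. Distinct words disagree
-- somewhere, which leaves fewer than `j q` agreements.
edge⇒root : ∀ {r} q j i i′ → Graph.Edge (wordGraph r (j ℕ.* q) q) i i′ →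
  ∃[ b ] b < j × agree (word {r} {j ℕ.* q} i) (word i′) ≡ b ℕ.* q
edge⇒root {r} q j i i′ (i≢i′ , q∣d) = fromDivides (ℕ.∣m+n∣m⇒∣n q∣d+a q∣d)
  where
  x y : Word r (j ℕ.* q)
  x = word i
  y = word i′
  d+a : disagree x y ℕ.+ agree x y ≡ j ℕ.* q
  d+a = trans (ℕ.+-comm (disagree x y) (agree x y)) (agree+disagree x y)
  q∣d+a : q ℕ.∣ disagree x y ℕ.+ agree x y
  q∣d+a = ℕ.divides j d+a
  d≢0 : ¬ disagree x y ≡ 0
  d≢0 d≡0 = i≢i′ (finToFun-injective {j ℕ.* q} {r} (disagree≡0⇒≗ x y d≡0))
  fromDivides : q ℕ.∣ agree x y → ∃[ b ] b < j × agree x y ≡ b ℕ.* q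
  fromDivides (ℕ.divides b eq) = b , ℕ.*-cancelʳ-< q b j (subst₂ _<_ eq d+a
    (ℕ.m<n+m (agree x y) (ℕ.n≢0⇒n>0 d≢0))) , eq

-- Lower bound for the Lovász number.

module _ (k q j : ℕ) .{{_ : ℕ.NonZero q}} where

  private
    r = suc k
    s = j ℕ.* q
    n = r ℕ.^ s
    P = constantPart r s q j
    U = diagonalRatio k s q j
    w : Fin n → Word r s
    w = word
    K : Fin n → Fin n → ℤ
    K i i′ = factors r s q j (agree (w i) (w i′))
    gram = factors-gram r s q j ℕ.≤-refl
    L = proj₁ gram

    instance
      n≢0 : ℕ.NonZero n
      n≢0 = ℕ.m^n≢0 r s
      P≢0 : ℕ.NonZero P
      P≢0 = constantPart≢0 r s q j ℕ.≤-refl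
      U≢0 : ℕ.NonZero U
      U≢0 = diagonalRatio≢0 k s q j
      PU≢0 : ℕ.NonZero (P ℕ.* U)
      PU≢0 = ℕ.m*n≢0 P U
      N≢0 : ℕ.NonZero (n ℕ.* (P ℕ.* U))
      N≢0 = ℕ.m*n≢0 n (P ℕ.* U)

  -- The feasible matrix is the product kernel scaled by `γ = 1 / (n P U)`, which makes its trace 1.
  -- The bound obtained is `n / U`, written without division.
  wordGraph-ϑ≥ : ∀ γ → 0ℚ ℚ.≤ γ → γ ℚ.* ι (+ (n ℕ.* (P ℕ.* U))) ≡ 1ℚ →
    ∀ {ϑ} → IsLovász (wordGraph r s q) ϑ → fromℚ (γ ℚ.* ι (+ (n ℕ.* (n ℕ.* P)))) ≤ℝ ϑ
  wordGraph-ϑ≥ γ 0≤γ γN≡1 {ϑ} isLovász =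
    ≤ℝ-trans (≤ℝ-pointwise (fromℚ (γ ℚ.* ι (+ (n ℕ.* (n ℕ.* P))))) (entrySum B) below)
      (IsLovász.maximal isLovász B feasible)
    where
    B : Matrix ℝ n
    B i i′ = fromℚ (γ ℚ.* ι (K i i′))

    K-diagonal : ∀ i → K i i ≡ + (P ℕ.* U)
    K-diagonal i = trans (cong (factors r s q j) (agree-refl (w i))) (factors-diagonal k s q j ℕ.≤-refl)

    K-gram : Gram {Word r s} (λ x y → factors r s q j (agree x y))
    K-gram = gram-≗ (proj₂ (proj₂ gram)) (gram-+ (gram-const P) (proj₁ (proj₂ gram)))

    trace : ∀ m → approx (sumℝ (λ i → B i i)) m ≡ 1ℚ
    trace m = begin
      approx (sumℝ (λ i → B i i)) m
        ≡⟨ approx-∑ (λ i → B i i) m ⟩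
      ∑ℚ.sum (λ i → γ ℚ.* ι (K i i))
        ≡⟨ ∑ℚ.sum-cong-≗ (λ i → cong (λ z → γ ℚ.* ι z) (K-diagonal i)) ⟩
      ∑ℚ.sum {n} (λ _ → γ ℚ.* ι (+ (P ℕ.* U)))
        ≡⟨ ∑-const n (γ ℚ.* ι (+ (P ℕ.* U))) ⟩
      ι (+ n) ℚ.* (γ ℚ.* ι (+ (P ℕ.* U)))
        ≡⟨ solve 3 (λ n γ d → n :* (γ :* d) := γ :* (n :* d)) refl (ι (+ n)) γ (ι (+ (P ℕ.* U))) ⟩
      γ ℚ.* (ι (+ n) ℚ.* ι (+ (P ℕ.* U)))
        ≡⟨ cong (γ ℚ.*_) (trans (sym (ι-* (+ n) (+ (P ℕ.* U)))) (cong ι (sym (ℤ.pos-* n (P ℕ.* U))))) ⟩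
      γ ℚ.* ι (+ (n ℕ.* (P ℕ.* U)))
        ≡⟨ γN≡1 ⟩
      1ℚ ∎
      where
      open ≡-Reasoning
      open ℚ.+-*-Solver

    -- At each index a real vector is a rational one, so the rational quadratic form decides the
    -- sign.
    nonNeg : ∀ x m → 0ℚ ℚ.≤ approx (sumℝ λ i → sumℝ λ i′ → x i *ℝ B i i′ *ℝ x i′) m
    nonNeg x m = subst (0ℚ ℚ.≤_) (sym (trans (approx-∑∑ (λ i i′ → x i *ℝ B i i′ *ℝ x i′) m)
      (trans (∑∑-cong λ i i′ → solve 4 (λ a γ b c → a :* (γ :* b) :* c := γ :* (a :* b :* c)) refl
                (approx (x i) m) γ (ι (K i i′)) (approx (x i′) m))
        (∑∑-scale γ (λ i i′ → approx (x i) m ℚ.* ι (K i i′) ℚ.* approx (x i′) m)))))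
      (*-nonNeg 0≤γ (gram-nonNeg K-gram w (λ i → approx (x i) m)))
      where open ℚ.+-*-Solver

    zeroOnEdges : ∀ i i′ → Graph.Edge (wordGraph r s q) i i′ → γ ℚ.* ι (K i i′) ≡ 0ℚ
    zeroOnEdges i i′ edge with edge⇒root {r} q j i i′ edge
    ... | b , b<j , a≡bq = trans (cong (λ z → γ ℚ.* ι z)
      (trans (cong (factors r s q j) a≡bq) (factors-root r s q j b b<j))) (ℚ.*-zeroʳ γ)

    feasible : LovászFeasible (wordGraph r s q) B
    feasible = record
      { psd = record
        { symmetric   = λ i i′ → ≃ℝ-pointwise (B i i′) (B i′ i)
            (λ _ → cong (λ a → γ ℚ.* ι (factors r s q j a)) (agree-sym (w i) (w i′)))
        ; nonNegative = λ x → ≤ℝ-pointwise 0ℝ (sumℝ λ i → sumℝ λ i′ → x i *ℝ B i i′ *ℝ x i′) (nonNeg x)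
        }
      ; trace-1       = ≃ℝ-pointwise (sumℝ (λ i → B i i)) 1ℝ trace
      ; zero-on-edges = λ i i′ edge → ≃ℝ-pointwise (B i i′) 0ℝ (λ _ → zeroOnEdges i i′ edge)
      }

    total : ι (+ (n ℕ.* (n ℕ.* P))) ℚ.≤ ∑ℚ.sum (λ i → ∑ℚ.sum (λ i′ → ι (K i i′)))
    total = begin
      ι (+ (n ℕ.* (n ℕ.* P)))
        ≡⟨ trans (cong ι (ℤ.pos-* n (n ℕ.* P))) (trans (ι-* (+ n) (+ (n ℕ.* P)))
             (cong (ι (+ n) ℚ.*_) (trans (cong ι (ℤ.pos-* n P)) (ι-* (+ n) (+ P))))) ⟩
      ι (+ n) ℚ.* (ι (+ n) ℚ.* ι (+ P))
        ≡⟨ trans (sym (∑-const n (ι (+ n) ℚ.* ι (+ P)))) (∑ℚ.sum-cong-≗ {n} (λ _ → sym (∑-const n (ι (+ P))))) ⟩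
      ∑P
        -- The entries of the positive semidefinite part `L` sum to its quadratic form at the
        -- all-ones vector.
        ≤⟨ x≤x+y (gram-nonNeg (proj₁ (proj₂ gram)) w (λ _ → 1ℚ)) ⟩
      ∑P ℚ.+ quadraticForm (λ i i′ → ι (L (w i) (w i′))) (λ _ → 1ℚ)
        ≡⟨ ∑∑-distrib-+ {n} {n} (λ _ _ → ι (+ P)) (λ i i′ → 1ℚ ℚ.* ι (L (w i) (w i′)) ℚ.* 1ℚ) ⟨
      ∑ℚ.sum (λ i → ∑ℚ.sum (λ i′ → ι (+ P) ℚ.+ 1ℚ ℚ.* ι (L (w i) (w i′)) ℚ.* 1ℚ))
        ≡⟨ ∑∑-cong (λ i i′ → trans
             (cong (ι (+ P) ℚ.+_) (trans (ℚ.*-identityʳ _) (ℚ.*-identityˡ (ι (L (w i) (w i′))))))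
             (trans (sym (ι-+ (+ P) (L (w i) (w i′)))) (cong ι (sym (proj₂ (proj₂ gram) (w i) (w i′)))))) ⟩
      ∑ℚ.sum (λ i → ∑ℚ.sum (λ i′ → ι (K i i′))) ∎
      where
      open ℚ.≤-Reasoning
      ∑P = ∑ℚ.sum {n} (λ _ → ∑ℚ.sum {n} (λ _ → ι (+ P)))

    below : ∀ m → γ ℚ.* ι (+ (n ℕ.* (n ℕ.* P))) ℚ.≤ approx (entrySum B) m
    below m = ℚ.≤-trans (*-monoˡ 0≤γ total)
      (ℚ.≤-reflexive (sym (trans (approx-∑∑ B m) (∑∑-scale γ (λ i i′ → ι (K i i′))))))

  -- Replacing `y` by the natural number `M` and `c₀` by `1 / C₀` reduces the real inequality to one
  -- between natural numbers.
  wordGraph-gap : ∀ {ϑ y : ℝ} m M C₀ c₀ → 0ℚ ℚ.≤ c₀ → c₀ ℚ.* ι (+ C₀) ≡ 1ℚ →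
    M ℕ.* m ℕ.* U ℕ.≤ n ℕ.* C₀ → y ≤ℝ fromℕ M → IsLovász (wordGraph r s q) ϑ →
    fromℚ c₀ *ℝ y *ℝ fromℕ m ≤ℝ ϑ
  wordGraph-gap {ϑ} {y} m M C₀ c₀ 0≤c₀ c₀C₀≡1 MmU≤nC₀ y≤M isLovász =
    ≤ℝ-trans (≤ℝ-scale y (fromℚ c₀ *ℝ y *ℝ fromℕ m) (c₀ ℚ.* ι (+ m)) (ι (+ M)) (*-nonNeg 0≤c₀ (0≤ι m)) y≤M
        (λ l → solve 3 (λ a b c → a :* b :* c := a :* c :* b) refl c₀ (approx y l) (ι (+ m))))
      (≤ℝ-trans
        (≤ℝ-pointwise (fromℚ (c₀ ℚ.* ι (+ m) ℚ.* ι (+ M))) (fromℚ (γ ℚ.* ι (+ (n ℕ.* (n ℕ.* P))))) (λ _ → compare))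
        (wordGraph-ϑ≥ γ 0≤γ γN≡1 isLovász))
    where
    open ℚ.+-*-Solver
    inv = reciprocal (0<ι (n ℕ.* (P ℕ.* U)))
    γ = proj₁ inv
    0≤γ = ℚ.<⇒≤ (proj₁ (proj₂ inv))
    γN≡1 = proj₂ (proj₂ inv)
    N = n ℕ.* (P ℕ.* U)
    T = n ℕ.* (n ℕ.* P)

    ι-*ℕ : ∀ a b → ι (+ (a ℕ.* b)) ≡ ι (+ a) ℚ.* ι (+ b)
    ι-*ℕ a b = trans (cong ι (ℤ.pos-* a b)) (ι-* (+ a) (+ b))

    -- The hypothesis multiplied by `n P`, since `n / U` appears in `wordGraph-ϑ≥` as `T / N`.
    natural : M ℕ.* m ℕ.* N ℕ.≤ T ℕ.* C₀
    natural = subst₂ ℕ._≤_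
      (ℕS.solve 5 (λ M m U n P → n ℕS.:* P ℕS.:* (M ℕS.:* m ℕS.:* U) ℕS.:= M ℕS.:* m ℕS.:* (n ℕS.:* (P ℕS.:* U))) refl M m U n P)
      (ℕS.solve 3 (λ n P C → n ℕS.:* P ℕS.:* (n ℕS.:* C) ℕS.:= n ℕS.:* (n ℕS.:* P) ℕS.:* C) refl n P C₀)
      (ℕ.*-monoʳ-≤ (n ℕ.* P) MmU≤nC₀)
      where module ℕS = ℕ.+-*-Solver

    compare : c₀ ℚ.* ι (+ m) ℚ.* ι (+ M) ℚ.≤ γ ℚ.* ι (+ T)
    compare = let open ℚ.≤-Reasoning in begin
      c₀ ℚ.* ι (+ m) ℚ.* ι (+ M)
        ≡⟨ trans (sym (ℚ.*-identityˡ _)) (cong (ℚ._* (c₀ ℚ.* ι (+ m) ℚ.* ι (+ M))) (sym γN≡1)) ⟩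
      γ ℚ.* ι (+ N) ℚ.* (c₀ ℚ.* ι (+ m) ℚ.* ι (+ M))
        ≡⟨ solve 5 (λ γ N c m M → γ :* N :* (c :* m :* M) := γ :* c :* (M :* m :* N)) refl
             γ (ι (+ N)) c₀ (ι (+ m)) (ι (+ M)) ⟩
      γ ℚ.* c₀ ℚ.* (ι (+ M) ℚ.* ι (+ m) ℚ.* ι (+ N))
        ≡⟨ cong (γ ℚ.* c₀ ℚ.*_) (sym (trans (ι-*ℕ (M ℕ.* m) N) (cong (ℚ._* ι (+ N)) (ι-*ℕ M m)))) ⟩
      γ ℚ.* c₀ ℚ.* ι (+ (M ℕ.* m ℕ.* N))
        ≤⟨ *-monoˡ (*-nonNeg 0≤γ 0≤c₀) (ι-mono (ℤ.+≤+ natural)) ⟩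
      γ ℚ.* c₀ ℚ.* ι (+ (T ℕ.* C₀))
        ≡⟨ cong (γ ℚ.* c₀ ℚ.*_) (ι-*ℕ T C₀) ⟩
      γ ℚ.* c₀ ℚ.* (ι (+ T) ℚ.* ι (+ C₀))
        ≡⟨ solve 4 (λ γ c T C → γ :* c :* (T :* C) := γ :* T :* (c :* C)) refl γ c₀ (ι (+ T)) (ι (+ C₀)) ⟩
      γ ℚ.* ι (+ T) ℚ.* (c₀ ℚ.* ι (+ C₀))
        ≡⟨ cong (γ ℚ.* ι (+ T) ℚ.*_) c₀C₀≡1 ⟩
      γ ℚ.* ι (+ T) ℚ.* 1ℚ
        ≡⟨ ℚ.*-identityʳ (γ ℚ.* ι (+ T)) ⟩
      γ ℚ.* ι (+ T) ∎

-- Choice of the parameters.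

ι-*-/ : ∀ d z → ι (+ suc d) ℚ.* (z ℚ./ suc d) ≡ ι z
ι-*-/ d z = ℚ.toℚᵘ-injective (ℚᵘ.≃-trans (ℚ.toℚᵘ-homo-* (ι (+ suc d)) (z ℚ./ suc d))
  (ℚᵘ.≃-trans (ℚᵘ.*-cong (toℚᵘ-ι (+ suc d)) (ℚ.toℚᵘ-fromℚᵘ (ℚᵘ.mkℚᵘ z d)))
    (ℚᵘ.≃-trans (ℚᵘ.*≡* cross) (ℚᵘ.≃-sym (toℚᵘ-ι z)))))
  where
  cross : + suc d ℤ.* z ℤ.* + 1 ≡ z ℤ.* (+ (1 ℕ.* suc d))
  cross = trans (ℤ.*-identityʳ (+ suc d ℤ.* z))
    (trans (ℤ.*-comm (+ suc d) z) (cong (λ m → z ℤ.* + m) (sym (ℕ.*-identityˡ (suc d)))))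

-- The denominator of `x` is a witness, as the numerator is at least 1.
archimedean : ∀ x → 0ℚ ℚ.< x → ∃[ b ] 1ℚ ℚ.≤ ι (+ b) ℚ.* x
archimedean x x>0 with x | ℚ.positive x>0
... | y@(ℚ.mkℚ (ℤ.+[1+ a ]) d _) | _ = suc d , (begin
  1ℚ                                    ≤⟨ ι-mono {+ 1} {+ suc a} (ℤ.+≤+ (ℕ.s≤s ℕ.z≤n)) ⟩
  ι (+ suc a)                           ≡⟨ ι-*-/ d (+ suc a) ⟨
  ι (+ suc d) ℚ.* (+ suc a ℚ./ suc d)   ≡⟨ cong (ι (+ suc d) ℚ.*_) (ℚ.↥p/↧p≡p y) ⟩
  ι (+ suc d) ℚ.* y                     ∎)
  where open ℚ.≤-Reasoning

^-distribʳ-* : ∀ m n o → (m ℕ.* n) ℕ.^ o ≡ m ℕ.^ o ℕ.* n ℕ.^ o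
^-distribʳ-* m n zero    = refl
^-distribʳ-* m n (suc o) = trans (cong (m ℕ.* n ℕ.*_) (^-distribʳ-* m n o))
  (solve 4 (λ m n a b → m :* n :* (a :* b) := m :* a :* (n :* b)) refl m n (m ℕ.^ o) (n ℕ.^ o))
  where open ℕ.+-*-Solver

n<m^n : ∀ m n → 1 < m → n < m ℕ.^ n
n<m^n m zero    1<m = ℕ.s≤s ℕ.z≤n
n<m^n m (suc n) 1<m = ℕ.≤-trans (ℕ.+-mono-≤ (ℕ.≤-trans (ℕ.s≤s ℕ.z≤n) (n<m^n m n 1<m)) (n<m^n m n 1<m))
  (subst (ℕ._≤ m ℕ.* m ℕ.^ n) (cong (m ℕ.^ n ℕ.+_) (ℕ.+-identityʳ (m ℕ.^ n))) (ℕ.*-monoˡ-≤ (m ℕ.^ n) 1<m))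

-- `gap` is a rational lower bound for `ε`. For `q = 2 + g` at least `2 / gap` it gives
-- `1 - ε ≤ 1 - 2 / q = g / q`, an exponent to which `IsPower.below` applies.
1-ε≤ : ∀ {ε} (0<ε : 0ℝ <ℝ ε) g → 1ℚ ℚ.+ 1ℚ ℚ.≤ ι (+ (2 ℕ.+ g)) ℚ.* _<ℝ_.gap 0<ε →
  (1ℝ -ℝ ε) ≤ℝ fromℚ ((g ℤ.⊖ 0) ℚ./ (2 ℕ.+ g))
1-ε≤ {ε} (mk< gap gap>0 (N , gap≤)) g 2≤qgap = mk≤ λ δ δ>0 → N , λ n N≤n → (begin
  1ℚ ℚ.- approx ε n   ≤⟨ ℚ.+-monoʳ-≤ 1ℚ (ℚ.neg-antimono-≤
                           (subst (ℚ._≤ approx ε n) (ℚ.+-identityˡ gap) (gap≤ n N≤n))) ⟩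
  1ℚ ℚ.- gap          ≤⟨ ℚ.*-cancelˡ-≤-pos q {{ℚ.positive (0<ι (2 ℕ.+ g))}} scaled ⟩
  + g ℚ./ (2 ℕ.+ g)   ≤⟨ x≤x+y (ℚ.<⇒≤ δ>0) ⟩
  + g ℚ./ (2 ℕ.+ g) ℚ.+ δ ∎)
  where
  open ℚ.≤-Reasoning
  open ℚ.+-*-Solver
  q = ι (+ (2 ℕ.+ g))
  scaled : q ℚ.* (1ℚ ℚ.- gap) ℚ.≤ q ℚ.* (+ g ℚ./ (2 ℕ.+ g))
  scaled = begin
    q ℚ.* (1ℚ ℚ.- gap)                    ≡⟨ solve 2 (λ q x → q :* (con 1ℚ :- x) := q :- q :* x) refl q gap ⟩
    q ℚ.- q ℚ.* gap                       ≤⟨ ℚ.+-monoʳ-≤ q (ℚ.neg-antimono-≤ 2≤qgap) ⟩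
    q ℚ.- (1ℚ ℚ.+ 1ℚ)                     ≡⟨ cong (ℚ._- (1ℚ ℚ.+ 1ℚ)) (ι-+ (+ 2) (+ g)) ⟩
    (1ℚ ℚ.+ 1ℚ) ℚ.+ ι (+ g) ℚ.- (1ℚ ℚ.+ 1ℚ) ≡⟨ solve 1 (λ x → (con 1ℚ :+ con 1ℚ) :+ x :- (con 1ℚ :+ con 1ℚ) := x) refl (ι (+ g)) ⟩
    ι (+ g)                               ≡⟨ ι-*-/ (suc g) (+ g) ⟨
    q ℚ.* (+ g ℚ./ (2 ℕ.+ g))             ∎

module _ (k g : ℕ) where

  private
    r = suc k
    q = 2 ℕ.+ g
    s = q ℕ.* q

  -- The order of the graph is `r ^ (q * q)`, so its power with exponent `g / q` is the integer
  -- `r ^ (q * g)`. `IsPower` compares the `q`-th powers, and the root is then cancelled.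
  power≤ : ∀ {x y} → x ≤ℝ fromℚ ((g ℤ.⊖ 0) ℚ./ q) → IsPower (r ℕ.^ s) x y → y ≤ℝ fromℕ (r ℕ.^ (q ℕ.* g))
  power≤ {x} {y} x≤ isPower = ^ℝ-cancel-≤ y (r ℕ.^ (q ℕ.* g)) (suc g)
    (subst (λ z → y ^ℝ q ≤ℝ fromℕ z) n^g≡M^q
      (≤ℝ-trans (≤ℝ-pointwise (y ^ℝ q) (1ℝ *ℝ y ^ℝ q) (λ n → ℚ.≤-reflexive (sym (ℚ.*-identityˡ (approx (y ^ℝ q) n)))))
        (IsPower.below isPower g 0 (suc g) x≤)))
    where
    open ≡-Reasoning
    open ℕ.+-*-Solver
    n^g≡M^q : (r ℕ.^ s) ℕ.^ g ≡ (r ℕ.^ (q ℕ.* g)) ℕ.^ q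
    n^g≡M^q = begin
      (r ℕ.^ s) ℕ.^ g          ≡⟨ ℕ.^-*-assoc r s g ⟩
      r ℕ.^ (q ℕ.* q ℕ.* g)    ≡⟨ cong (r ℕ.^_) (solve 2 (λ q g → q :* q :* g := q :* g :* q) refl q g) ⟩
      r ℕ.^ (q ℕ.* g ℕ.* q)    ≡⟨ ℕ.^-*-assoc r (q ℕ.* g) q ⟨
      (r ℕ.^ (q ℕ.* g)) ℕ.^ q  ∎

  -- The exponents of `r` on the left add up to `q g + (q - 1) + q = s - 1`, and the remaining
  -- factor depends on `q` alone.
  product≤ : ∀ {m u} → m ℕ.≤ 2 ℕ.^ s ℕ.* r ℕ.^ suc g → u ℕ.≤ (r ℕ.* 2 ℕ.^ s) ℕ.^ q →
    r ℕ.^ (q ℕ.* g) ℕ.* m ℕ.* u ℕ.≤ r ℕ.^ s ℕ.* ((2 ℕ.^ s) ℕ.^ q ℕ.* 2 ℕ.^ s)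
  product≤ {m} {u} m≤ u≤ = begin
    r ℕ.^ (q ℕ.* g) ℕ.* m ℕ.* u
      ≤⟨ ℕ.*-mono-≤ (ℕ.*-monoʳ-≤ (r ℕ.^ (q ℕ.* g)) m≤) u≤ ⟩
    r ℕ.^ (q ℕ.* g) ℕ.* (t ℕ.* r ℕ.^ suc g) ℕ.* (r ℕ.* t) ℕ.^ q
      ≡⟨ cong (r ℕ.^ (q ℕ.* g) ℕ.* (t ℕ.* r ℕ.^ suc g) ℕ.*_) (^-distribʳ-* r t q) ⟩
    r ℕ.^ (q ℕ.* g) ℕ.* (t ℕ.* r ℕ.^ suc g) ℕ.* (r ℕ.^ q ℕ.* t ℕ.^ q)
      ≡⟨ solve 5 (λ a t b c d → a :* (t :* b) :* (c :* d) := a :* (b :* c) :* (d :* t)) refl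
           (r ℕ.^ (q ℕ.* g)) t (r ℕ.^ suc g) (r ℕ.^ q) (t ℕ.^ q) ⟩
    r ℕ.^ (q ℕ.* g) ℕ.* (r ℕ.^ suc g ℕ.* r ℕ.^ q) ℕ.* (t ℕ.^ q ℕ.* t)
      ≡⟨ cong (ℕ._* (t ℕ.^ q ℕ.* t)) (trans
           (cong (r ℕ.^ (q ℕ.* g) ℕ.*_) (sym (ℕ.^-distribˡ-+-* r (suc g) q)))
           (sym (ℕ.^-distribˡ-+-* r (q ℕ.* g) (suc g ℕ.+ q)))) ⟩
    r ℕ.^ (q ℕ.* g ℕ.+ (suc g ℕ.+ q)) ℕ.* (t ℕ.^ q ℕ.* t)
      ≤⟨ ℕ.*-monoˡ-≤ (t ℕ.^ q ℕ.* t) (ℕ.^-monoʳ-≤ r exponent≤) ⟩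
    r ℕ.^ s ℕ.* (t ℕ.^ q ℕ.* t) ∎
    where
    open ℕ.≤-Reasoning
    open ℕ.+-*-Solver
    t = 2 ℕ.^ s
    exponent≤ : q ℕ.* g ℕ.+ (suc g ℕ.+ q) ℕ.≤ q ℕ.* q
    exponent≤ = ℕ.≤-trans (ℕ.n≤1+n _) (ℕ.≤-reflexive
      (solve 1 (λ g → con 1 :+ ((con 2 :+ g) :* g :+ (con 1 :+ g :+ (con 2 :+ g))) :=
        (con 2 :+ g) :* (con 2 :+ g)) refl g))

theorem10 : (ε : ℝ) → 0ℝ <ℝ ε → (p : ℕ) (p-prime : Prime p) →
    Σ[ n ∈ (ℕ → ℕ) ] Σ[ G ∈ ((k : ℕ) → Graph (n k)) ]
    ((k : ℕ) → k < n k) ×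
    Σ[ c ∈ ℝ ] 0ℝ <ℝ c ×
    ((k : ℕ) (ϑ y : ℝ) (m : ℕ) →
    IsLovász (G k) ϑ → IsMinrank (𝔽 p p-prime) (G k) m → IsPower (n k) (1ℝ -ℝ ε) y →
    c *ℝ y *ℝ fromℕ m ≤ℝ ϑ)
theorem10 ε 0<ε p p-prime =
  -- The alphabet has `k + 1` letters, while `q` and the length `s` are the same for all `k`.
  (λ k → suc k ℕ.^ s) , (λ k → wordGraph (suc k) s q) ,
  -- As `s` is positive, `suc k` is one factor of the order, so the orders are unbounded.
  (λ k → ℕ.m≤m*n (suc k) (suc k ℕ.^ ℕ.pred s) {{ℕ.m^n≢0 (suc k) (ℕ.pred s)}}) ,
  fromℚ c₀ , mk< c₀ 0<c₀ (0 , λ _ _ → ℚ.≤-reflexive (ℚ.+-identityˡ c₀)) ,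
  λ k ϑ y m isLovász isMinrank isPower →
    wordGraph-gap k q q m (suc k ℕ.^ (q ℕ.* g)) C₀ c₀ (ℚ.<⇒≤ 0<c₀) c₀C₀≡1
      (product≤ k g (wordGraph-minrank≤ p-prime e (suc g) (suc k) s m p^e≡q isMinrank) (diagonalRatio≤ k s q q))
      (power≤ k g (1-ε≤ 0<ε g 2≤q*gap) isPower)
      isLovász
  where
  gap = _<ℝ_.gap 0<ε
  arch = archimedean gap (_<ℝ_.gap>0 0<ε)
  b = proj₁ arch
  -- From `p ^ e > e > 2 b` follows `q * gap ≥ 2`. The successor also ensures `p ^ e ≥ 2`, so that
  -- the subtraction in `g` is not truncated.
  e = suc (2 ℕ.* b)
  e<p^e : e < p ℕ.^ e
  e<p^e = n<m^n p e (ℕ.nonTrivial⇒n>1 p {{prime⇒nonTrivial p-prime}})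
  g = p ℕ.^ e ℕ.∸ 2
  q = 2 ℕ.+ g
  s = q ℕ.* q
  p^e≡q : p ℕ.^ e ≡ q
  p^e≡q = sym (ℕ.m+[n∸m]≡n (ℕ.≤-trans (ℕ.s≤s (ℕ.s≤s ℕ.z≤n)) e<p^e))
  2≤q*gap : 1ℚ ℚ.+ 1ℚ ℚ.≤ ι (+ q) ℚ.* gap
  2≤q*gap = begin
    1ℚ ℚ.+ 1ℚ                              ≤⟨ ℚ.+-mono-≤ (proj₂ arch) (proj₂ arch) ⟩
    ι (+ b) ℚ.* gap ℚ.+ ι (+ b) ℚ.* gap    ≡⟨ ℚ.*-distribʳ-+ gap (ι (+ b)) (ι (+ b)) ⟨
    (ι (+ b) ℚ.+ ι (+ b)) ℚ.* gap          ≡⟨ cong (ℚ._* gap) (sym (ι-+ (+ b) (+ b))) ⟩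
    ι (+ (b ℕ.+ b)) ℚ.* gap                ≤⟨ ℚ.*-monoʳ-≤-nonNeg gap {{ℚ.nonNegative (ℚ.<⇒≤ (_<ℝ_.gap>0 0<ε))}}
                                                (ι-mono (ℤ.+≤+ 2b≤q)) ⟩
    ι (+ q) ℚ.* gap                        ∎
    where
    open ℚ.≤-Reasoning
    2b≤q : b ℕ.+ b ℕ.≤ q
    2b≤q = subst₂ ℕ._≤_ (cong (b ℕ.+_) (ℕ.+-identityʳ b)) p^e≡q (ℕ.<⇒≤ (ℕ.<-trans (ℕ.n<1+n (2 ℕ.* b)) e<p^e))
  -- Independent of `k`, so its reciprocal serves as the constant for the whole family.
  C₀ = (2 ℕ.^ s) ℕ.^ q ℕ.* 2 ℕ.^ s
  C₀≢0 : ℕ.NonZero C₀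
  C₀≢0 = ℕ.m*n≢0 ((2 ℕ.^ s) ℕ.^ q) (2 ℕ.^ s) {{ℕ.m^n≢0 (2 ℕ.^ s) q {{ℕ.m^n≢0 2 s}}}} {{ℕ.m^n≢0 2 s}}
  inv = reciprocal (0<ι C₀ {{C₀≢0}})
  c₀ = proj₁ inv
  0<c₀ = proj₁ (proj₂ inv)
  c₀C₀≡1 = proj₂ (proj₂ inv)
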